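{- Let $n\geq 3$. (i) Let $H$ be an $n\times n$ unreduced upper Hessenberg $0/1$-matrix whose columns together with the origin are the $n+1$ vertices of an $n$-simplex in $[0,1]^n$ with acute dihedral angles only; equivalently, $G=H^\top H$ is invertible, every off-diagonal entry of $G^{ -1}$ is negative and every row sum of $G^{ -1}$ is positive. Then, possibly after exchanging its first two rows and/or its last two columns, $H$ is equal to the matrix $H_\lambda$ for some composition $\lambda=\langle\lambda_1,\dots,\lambda_k\rangle$ of $n-1$ with $\lambda_1\geq 2$ and $\lambda_k\geq 2$. (ii) For every such composition $\lambda$, $$|\det(H_\lambda)|=f_k,\qquad\text{where}\qquad \frac{f_k}{g_k}=\lambda_1+\cfrac{1}{\lambda_2+\cfrac{1}{\ddots+\cfrac{1}{\lambda_k}}},\quad \gcd(f_k,g_k)=1 .$$ (iii) Conversely, for every such composition $\lambda$ the Gramian $H_\lambda^\top H_\lambda$ is strictly ultrametric, which implies that the columns of $H_\lambda$ together with the origin are the vertices of an acute $0/1$-simplex.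
   Context: An $n\times n$ matrix $H=(h_{ij})$ is unreduced upper Hessenberg if $h_{ij}=0$ whenever $i>j+1$ and $h_{j+1,j}\neq 0$ for all $j$. A composition of an integer $m$ into $k$ parts is an ordered tuple $\langle\lambda_1,\dots,\lambda_k\rangle$ of positive integers with $\lambda_1+\dots+\lambda_k=m$. Definition of $H_\lambda$: let $\lambda=\langle\lambda_1,\dots,\lambda_k\rangle$ be a composition of $n-1$ with $\lambda_1,\lambda_k\geq 2$. Partition the rows $1,\dots,n$ into consecutive blocks $R_0,R_1,\dots,R_k$, where $R_0=\{1\}$ and $R_j$ ($j\geq1$) consists of the next $\lambda_j$ rows; partition the columns $1,\dots,n$ into consecutive blocks $C_1,\dots,C_k,C_{k+1}$, where $C_j$ ($j\le k$) has $\lambda_j$ columns and $C_{k+1}=\{n\}$. $H_\lambda$ is the $n\times n$ $0/1$-matrix whose block $(R_j,C_j)$ is the identity matrix $I_{\lambda_j}$ for $1\leq j\leq k$, whose blocks $(R_i,C_j)$ with $i>j$ are zero, and whose blocks $(R_i,C_j)$ with $0\le i<j\le k+1$ consist entirely of ones if $j-i$ is odd and entirely of zeros if $j-i$ is even. (E.g. for $\lambda=\langle 2\rangle$, $H_\lambda$ has rows $(1,1,0),(1,0,1),(0,1,1)$.) A symmetric matrix is called strictly ultrametric (in the sense used here) if each of its $3\times3$ principal submatrices is, after a simultaneous permutation of rows and columns, of the form $\begin{bmatrix} d&b&a\\ b&c&a\\ a&a&f\end{bmatrix}$ with $a\leq b<c\leq d$ and $a<f$. A $0/1$-simplex is acute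 if all its dihedral angles are acute; for a simplex with the origin as a vertex and other vertices the columns of $P$, this is equivalent to $G=P^\top P$ being invertible with $G^{ -1}$ having negative off-diagonal entries and positive row sums. -}

module Defs where

open import Algebra.Bundles using (CommutativeRing)
open import Data.Bool.Base using (Bool; if_then_else_)
open import Data.Fin.Base as Fin using (Fin; zero; suc; toℕ; punchIn; opposite)
open import Data.Fin.Permutation using (Permutation′; _⟨$⟩ʳ_)
open import Data.Fin.Properties using (_≟_)
open import Data.Integer.Base using (+_)
open import Data.Nat.Base as ℕ using (ℕ; zero; suc; _∸_; parity)
open import Data.Nat.Properties using (<-cmp)
open import Data.Parity.Base using (0ℙ; 1ℙ)
open import Data.Product.Base using (_×_; _,_; ∃-syntax; Σ-syntax; map₁)
open import Data.Rational.Base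
  using (ℚ; 0ℚ; 1ℚ; _+_; _*_; -_; 1/_; _/_; _≤_; _<_; _>_; Positive)
open import Data.Rational.Properties
  using (+-*-commutativeRing; pos⇒nonZero; pos+pos⇒pos; 1/pos⇒pos; normalize-pos)
open import Data.Sum.Base using (_⊎_)
open import Data.Vec.Base as Vec using (Vec)
open import Data.Vec.Functional using (Vector; []; _∷_; zipWith; transpose)
open import Data.Vec.Relation.Unary.All as All using (All)
open import Function.Base using (_∘_; id)
open import Relation.Binary.Definitions using (tri<; tri≈; tri>)
open import Relation.Binary.PropositionalEquality.Core using (_≡_; _≢_)
open import Relation.Nullary.Decidable.Core using (does)

open import Algebra.Properties.Semiring.Sum
  (CommutativeRing.semiring +-*-commutativeRing) using (sum)
open import Algebra.Properties.Semiring.Exp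
  (CommutativeRing.semiring +-*-commutativeRing) using (_^_)

-- Everything below is about 0/1-matrices and 0/1-points, so ℚ is a large enough
-- field: linear independence, signs of inner products, inverses and
-- determinants agree with those computed over the reals.

Matrix : ℕ → Set
Matrix n = Vector (Vector ℚ n) n

infixl 7 _∙_ _⊗_

_∙_ : ∀ {n} → Vector ℚ n → Vector ℚ n → ℚ
u ∙ v = sum (zipWith _*_ u v)

_⊗_ : ∀ {n} → Matrix n → Matrix n → Matrix n
(A ⊗ B) i j = A i ∙ transpose B j

identity : ∀ {n} → Matrix n
identity i j = if does (i ≟ j) then 1ℚ else 0ℚ

gram : ∀ {n} → Matrix n → Matrix n
gram P = transpose P ⊗ P

-- Laplace expansion along the first column.
det : ∀ {n} → Matrix n → ℚ
det {zero}  A = 1ℚ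
det {suc n} A =
  sum (λ i → (- 1ℚ) ^ toℕ i * A i zero * det (λ r c → A (punchIn i r) (suc c)))

record IsInverse {n} (A N : Matrix n) : Set where
  field
    inverseˡ : ∀ i j → (N ⊗ A) i j ≡ identity i j
    inverseʳ : ∀ i j → (A ⊗ N) i j ≡ identity i j

Is01 : ℚ → Set
Is01 x = x ≡ 0ℚ ⊎ x ≡ 1ℚ

Is01Matrix : ∀ {n} → Matrix n → Set
Is01Matrix A = ∀ i j → Is01 (A i j)

record IsUnreducedUpperHessenberg {n} (H : Matrix n) : Set where
  field
    upperHessenberg : ∀ i j → toℕ i ℕ.> suc (toℕ j) → H i j ≡ 0ℚ
    unreduced       : ∀ i j → toℕ i ≡ suc (toℕ j) → H i j ≢ 0ℚ

-- Permutes indices 0 and 1; the identity if there are fewer than two indices.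
swapFirstTwo : ∀ {n} → Fin n → Fin n
swapFirstTwo {suc (suc n)} zero       = suc zero
swapFirstTwo {suc (suc n)} (suc zero) = zero
swapFirstTwo               i          = i

swapLastTwo : ∀ {n} → Fin n → Fin n
swapLastTwo = opposite ∘ swapFirstTwo ∘ opposite

exchangeFirstTwoRows : ∀ {n} → Matrix n → Matrix n
exchangeFirstTwoRows A i j = A (swapFirstTwo i) j

exchangeLastTwoColumns : ∀ {n} → Matrix n → Matrix n
exchangeLastTwoColumns A i j = A i (swapLastTwo j)

possibly : ∀ {n} → Bool → (Matrix n → Matrix n) → Matrix n → Matrix n
possibly b f = if b then f else id

Points : ℕ → Set
Points n = Vector (Vector ℚ n) (suc n)

originAndColumns : ∀ {n} → Matrix n → Points n
originAndColumns P = (λ _ → 0ℚ) ∷ transpose P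

AffinelyIndependent : ∀ {n} → Points n → Set
AffinelyIndependent v =
  ∀ c → sum c ≡ 0ℚ → (∀ r → c ∙ (λ i → v i r) ≡ 0ℚ) → ∀ i → c i ≡ 0ℚ

-- u is orthogonal to the facet opposite the vertex v i and points to the side of
-- that facet on which v i lies.
record IsInwardNormal {n} (v : Points n) (i : Fin (suc n)) (u : Vector ℚ n) : Set where
  field
    orthogonal : ∀ j k → j ≢ i → k ≢ i → u ∙ v j ≡ u ∙ v k
    inward     : ∀ j → j ≢ i → u ∙ v j < u ∙ v i

-- A dihedral angle is π minus the angle between inward normals of the two
-- facets, so it is acute iff the inner product of these normals is negative.
-- In a nondegenerate simplex each facet has an inward normal, unique up to a
-- positive factor, so the choice of u and w is immaterial.
AcuteDihedralAngle : ∀ {n} → Points n → Fin (suc n) → Fin (suc n) → Set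
AcuteDihedralAngle v i j =
  ∃[ u ] ∃[ w ] IsInwardNormal v i u × IsInwardNormal v j w × u ∙ w < 0ℚ

record IsAcute01Simplex {n} (v : Points n) : Set where
  field
    zeroOne     : ∀ i r → Is01 (v i r)
    independent : AffinelyIndependent v
    acute       : ∀ i j → i ≢ j → AcuteDihedralAngle v i j

-- The characterization of acuteness in terms of G = PᵀP.
record HasAcuteInverse {n} (G : Matrix n) : Set where
  field
    inverse       : Matrix n
    isInverse     : IsInverse G inverse
    offDiagonal<0 : ∀ i j → i ≢ j → inverse i j < 0ℚ
    rowSum>0      : ∀ i → sum (inverse i) > 0ℚ

ultrametricPattern : (a b c d f : ℚ) → Matrix 3
ultrametricPattern a b c d f =
  (d ∷ b ∷ a ∷ []) ∷
  (b ∷ c ∷ a ∷ []) ∷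
  (a ∷ a ∷ f ∷ []) ∷ []

-- A principal submatrix is selected by a strictly increasing map s of indices.
record IsStrictlyUltrametric {n} (G : Matrix n) : Set where
  field
    symmetric    : ∀ i j → G i j ≡ G j i
    threeByThree :
      ∀ (s : Fin 3 → Fin n) → (∀ p q → p Fin.< q → s p Fin.< s q) →
      Σ[ π ∈ Permutation′ 3 ] ∃[ a ] ∃[ b ] ∃[ c ] ∃[ d ] ∃[ f ]
        (∀ p q → G (s (π ⟨$⟩ʳ p)) (s (π ⟨$⟩ʳ q)) ≡ ultrametricPattern a b c d f p q)
        × a ≤ b × b < c × c ≤ d × a < f

record Composition (m k : ℕ) : Set where
  field
    parts    : Vec ℕ k
    positive : All ℕ.NonZero parts
    total    : Vec.sum parts ≡ m

-- Splits 0, 1, 2, … into consecutive blocks of the given sizes and returns the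
-- number of the block containing i (counted from 0) and the position of i in it.
-- Everything after the k given blocks forms one last block, numbered k.
locate : ∀ {k} → Vec ℕ k → ℕ → ℕ × ℕ
locate Vec.[]       i = 0 , i
locate (a Vec.∷ as) i = if i ℕ.<ᵇ a then (0 , i) else map₁ suc (locate as (i ∸ a))

-- R_0 is row 0 alone; the blocks R_1, R_2, … start at row 1.
rowBlock : ∀ {k} → Vec ℕ k → ℕ → ℕ × ℕ
rowBlock parts zero    = 0 , 0
rowBlock parts (suc i) = map₁ suc (locate parts i)

-- The column blocks are numbered from 1; C_{k+1} is the remainder after C_k.
colBlock : ∀ {k} → Vec ℕ k → ℕ → ℕ × ℕ
colBlock parts j = map₁ suc (locate parts j)

-- The entry at position (p , q) of the block (R_I , C_J).
blockEntry : ℕ × ℕ → ℕ × ℕ → ℚ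
blockEntry (I , p) (J , q) with <-cmp I J
... | tri> _ _ _ = 0ℚ
... | tri≈ _ _ _ = if p ℕ.≡ᵇ q then 1ℚ else 0ℚ
... | tri< _ _ _ with parity (J ∸ I)
...   | 0ℙ = 0ℚ
...   | 1ℙ = 1ℚ

Hλ : ∀ n {k} → Composition (ℕ.pred n) k → Matrix n
Hλ n comp i j = blockEntry (rowBlock parts (toℕ i)) (colBlock parts (toℕ j))
  where open Composition comp

-- a₁ + 1/(a₂ + 1/(… + 1/aₖ)); positivity is carried along to make 1/ defined.
mutual
  contFrac : ∀ {k} (as : Vec ℕ (suc k)) → All ℕ.NonZero as → ℚ
  contFrac (a Vec.∷ Vec.[])     _            = + a / 1
  contFrac (a Vec.∷ b Vec.∷ as) (_ All.∷ nz) =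
    + a / 1 + (1/ tail) {{pos⇒nonZero tail {{contFrac-pos (b Vec.∷ as) nz}}}}
    where tail = contFrac (b Vec.∷ as) nz

  contFrac-pos : ∀ {k} (as : Vec ℕ (suc k)) (nz : All ℕ.NonZero as) →
                 Positive (contFrac as nz)
  contFrac-pos (a Vec.∷ Vec.[])     (a≢0 All.∷ _)  = normalize-pos a 1 {{_}} {{a≢0}}
  contFrac-pos (a Vec.∷ b Vec.∷ as) (a≢0 All.∷ nz) =
    pos+pos⇒pos (+ a / 1) {{normalize-pos a 1 {{_}} {{a≢0}}}}
      ((1/ tail) {{pos⇒nonZero tail {{tail>0}}}}) {{1/pos⇒pos tail {{tail>0}}}}
    where
    tail = contFrac (b Vec.∷ as) nz
    tail>0 = contFrac-pos (b Vec.∷ as) nz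

contFracOf : ∀ {m k} → Composition m (suc k) → ℚ
contFracOf comp = contFrac parts positive
  where open Composition comp

record EndPartsAtLeast2 {m k} (comp : Composition m (suc k)) : Set where
  open Composition comp
  field
    first≥2 : Vec.head parts ℕ.≥ 2
    last≥2  : Vec.last parts ℕ.≥ 2

{-# OPTIONS --safe #-}
module Submission where

-- Colour the columns of an unreduced upper Hessenberg 0/1-matrix H with two
-- colours, and give row i + 1 the colour opposite to that of column i.  If H is
-- acute, the facet normals (the rows of the inverse) have the sign pattern of H:
-- positive where H is 1 and negative where H is 0.  Orthogonality of the normals
-- to the columns, read column by column from the left, then forces each row to
-- be equal or complementary to row 0 to the right of the diagonal, so H is
-- recovered from a colouring whose last two colours differ.  The lengths of its
-- monochromatic runs are the composition λ, and exchanging the first two rows or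
-- the last two columns recolours the ends so that the end runs have length ≥ 2.
-- Conversely the Gramian of such a matrix is the all-ones matrix plus a matrix
-- built from 1 by adding a diagonal entry 1 and adding u uᵀ for the indicator u
-- of a colour.  Both operations preserve ultrametricity and, by the
-- Sherman–Morrison formula, the sign pattern of the inverse.

open import Defs
open import Algebra.Bundles using (CommutativeRing)
import Data.Bool.Properties as Bool
open import Data.Bool.Base using (Bool; true; false; T; not; if_then_else_)
open import Data.Empty using (⊥; ⊥-elim)
open import Data.Fin.Base as Fin using (Fin; zero; suc; punchIn; toℕ; inject₁; opposite)
open import Data.Fin.Permutation as Permutation using (Permutation′; _⟨$⟩ʳ_; _∘ₚ_)
import Data.Fin.Properties as Fin
open import Data.Integer.Base as ℤ using (+_)
import Data.Integer.Properties as ℤ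
open import Data.Nat.Base as ℕ using (ℕ; zero; suc; pred; _≥_; _∸_; parity; NonZero; z≤n; s≤s)
open import Data.Nat.Coprimality using (Coprime; coprime-divisor; gcd≡1⇒coprime)
open import Data.Nat.Divisibility using (divides; ∣-antisym; ∣m+n∣m⇒∣n; ∣n⇒∣m*n; ∣1⇒≡1)
open import Data.Nat.GCD using (gcd)
import Data.Nat.Properties as ℕ
open import Data.Parity.Base using (Parity; 0ℙ; 1ℙ)
open import Data.Product.Base using (_×_; _,_; ∃-syntax; Σ-syntax; proj₁; proj₂)
open import Data.Rational.Base as ℚ hiding (_≥_; NonZero)
open import Data.Rational.Properties
open import Data.Rational.Solver using (module +-*-Solver)
import Data.Rational.Unnormalised.Base as ℚᵘ
import Data.Rational.Unnormalised.Properties as ℚᵘ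
open import Data.Sum.Base as Sum using (_⊎_; inj₁; inj₂)
open import Data.Vec.Base as Vec using (Vec)
open import Data.Vec.Functional using (Vector; transpose; insertAt) renaming (_∷_ to _◂_)
open import Data.Vec.Functional.Properties using (insertAt-lookup; insertAt-punchIn)
open import Data.Vec.Relation.Unary.All as All using (All)
open import Function.Base using (_∘_)
open import Function.Bundles using (_⇔_; mk⇔)
open import Relation.Binary.Definitions using (tri<; tri≈; tri>)
open import Relation.Binary.PropositionalEquality
open import Relation.Nullary.Decidable using (yes; no; does; ¬?; dec-true; dec-false; decidable-stable)
open import Algebra.Properties.Semiring.Exp
  (CommutativeRing.semiring +-*-commutativeRing) using (_^_)
open import Algebra.Properties.Semiring.Sum
  (CommutativeRing.semiring +-*-commutativeRing)
  using (sum; sum-cong-≗; sum-replicate-zero; ∑-distrib-+; ∑-comm; sum-remove;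
         *-distribˡ-sum; *-distribʳ-sum)
open +-*-Solver using (solve; _:+_; _:*_; :-_; _:-_; _:=_; con)
open ≡-Reasoning

-- Finite sums and inner products

-- The obstacle in the classification is that, once some columns have been read, an orthogonality
-- relation still involves all earlier rows of the matrix of normals. These rows fall into two
-- groups, one for each of two complementary patterns on the remaining columns, and only the two
-- group sums matter. In the next column just one group and the new row contribute, so on the later
-- columns the new row of normals is the negative of a group sum, whose signs are known because the
-- members of a group share theirs. The group complementary to row 0 starts out empty, with sum
-- zero: hence the weak signs in the invariant, and hence the corner entry of `H` must be 1, for
-- otherwise row 1 of the normals would vanish to the right of column 0. In the converse, the two
-- colours stay decoupled until the all-ones matrix is added. Up to then the off-diagonal entries of
-- the inverse may be zero; that last update makes all of them negative.

sum-zero : ∀ {n} (f : Vector ℚ n) → (∀ i → f i ≡ 0ℚ) → sum f ≡ 0ℚ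
sum-zero {n} f f≡0 = trans (sum-cong-≗ f≡0) (sum-replicate-zero n)

sum-neg : ∀ {n} (f : Vector ℚ n) → sum (λ i → - f i) ≡ - sum f
sum-neg {zero}  f = refl
sum-neg {suc n} f =
  trans (cong (λ ξ → - f zero + ξ) (sum-neg (f ∘ suc))) (sym (neg-distrib-+ (f zero) _))

∙-congˡ : ∀ {n} (u : Vector ℚ n) {v w : Vector ℚ n} → (∀ i → v i ≡ w i) → u ∙ v ≡ u ∙ w
∙-congˡ u v≗w = sum-cong-≗ λ i → cong (u i *_) (v≗w i)

∙-congʳ : ∀ {n} {u v : Vector ℚ n} (w : Vector ℚ n) → (∀ i → u i ≡ v i) → u ∙ w ≡ v ∙ w
∙-congʳ w u≗v = sum-cong-≗ λ i → cong (_* w i) (u≗v i)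

∙-comm : ∀ {n} (u v : Vector ℚ n) → u ∙ v ≡ v ∙ u
∙-comm u v = sum-cong-≗ λ i → *-comm (u i) (v i)

∙-zeroˡ : ∀ {n} (u : Vector ℚ n) → (λ _ → 0ℚ) ∙ u ≡ 0ℚ
∙-zeroˡ u = sum-zero _ λ i → *-zeroˡ (u i)

∙-zeroʳ : ∀ {n} (u : Vector ℚ n) → u ∙ (λ _ → 0ℚ) ≡ 0ℚ
∙-zeroʳ u = trans (∙-comm u _) (∙-zeroˡ u)

∙-distribˡ-+ : ∀ {n} (u v w : Vector ℚ n) → u ∙ (λ i → v i + w i) ≡ u ∙ v + u ∙ w
∙-distribˡ-+ u v w =
  trans (sum-cong-≗ λ i → *-distribˡ-+ (u i) (v i) (w i)) (∑-distrib-+ (λ i → u i * v i) (λ i → u i * w i))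

∙-scaleʳ : ∀ {n} x (u v : Vector ℚ n) → u ∙ (λ i → x * v i) ≡ x * (u ∙ v)
∙-scaleʳ x u v = trans
  (sum-cong-≗ λ i → solve 3 (λ x a b → a :* (x :* b) := x :* (a :* b)) refl x (u i) (v i))
  (sym (*-distribˡ-sum x λ i → u i * v i))

∙-scaleˡ : ∀ {n} x (u v : Vector ℚ n) → (λ i → x * u i) ∙ v ≡ x * (u ∙ v)
∙-scaleˡ x u v = trans (∙-comm _ v) (trans (∙-scaleʳ x v u) (cong (x *_) (∙-comm v u)))

∙-negʳ : ∀ {n} (u v : Vector ℚ n) → u ∙ (λ i → - v i) ≡ - (u ∙ v)
∙-negʳ u v = trans (sum-cong-≗ λ i → sym (neg-distribʳ-* (u i) (v i))) (sum-neg λ i → u i * v i)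

∙-assoc : ∀ {m n} (u : Vector ℚ m) (M : Vector (Vector ℚ n) m) (v : Vector ℚ n) →
          (λ j → u ∙ (λ k → M k j)) ∙ v ≡ u ∙ (λ k → M k ∙ v)
∙-assoc u M v = begin
  sum (λ j → u ∙ (λ k → M k j) * v j)
    ≡⟨ sum-cong-≗ (λ j → *-distribʳ-sum (v j) λ k → u k * M k j) ⟩
  sum (λ j → sum λ k → u k * M k j * v j)
    ≡⟨ ∑-comm (λ j k → u k * M k j * v j) ⟩
  sum (λ k → sum λ j → u k * M k j * v j)
    ≡⟨ sum-cong-≗ (λ k → sum-cong-≗ λ j → *-assoc (u k) (M k j) (v j)) ⟩
  sum (λ k → sum λ j → u k * (M k j * v j))
    ≡⟨ sum-cong-≗ (λ k → *-distribˡ-sum (u k) λ j → M k j * v j) ⟨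
  sum (λ k → u k * (M k ∙ v)) ∎

sum-∙ : ∀ {m n} (u : Vector ℚ n) (M : Vector (Vector ℚ n) m) →
        sum (λ k → u ∙ M k) ≡ u ∙ (λ j → sum λ k → M k j)
sum-∙ u M = trans (∑-comm λ k j → u j * M k j)
  (sym (sum-cong-≗ λ j → *-distribˡ-sum (u j) λ k → M k j))

identity-diagonal : ∀ {n} (i : Fin n) → identity i i ≡ 1ℚ
identity-diagonal i with i Fin.≟ i
... | yes _ = refl
... | no i≢i = ⊥-elim (i≢i refl)

identity-offDiagonal : ∀ {n} {i j : Fin n} → i ≢ j → identity i j ≡ 0ℚ
identity-offDiagonal {i = i} {j} i≢j with i Fin.≟ j
... | yes i≡j = ⊥-elim (i≢j i≡j)
... | no _ = refl

identity-suc : ∀ {n} (i j : Fin n) → identity (suc i) (suc j) ≡ identity i j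
identity-suc i j with i Fin.≟ j
... | yes _ = refl
... | no _ = refl

identity-sym : ∀ {n} (i j : Fin n) → identity i j ≡ identity j i
identity-sym i j with i Fin.≟ j
... | yes refl = sym (identity-diagonal i)
... | no i≢j = sym (identity-offDiagonal (i≢j ∘ sym))

∙-identityʳ : ∀ {n} (u : Vector ℚ n) i → u ∙ identity i ≡ u i
∙-identityʳ {suc n} u zero = begin
  u zero * 1ℚ + sum (λ j → u (suc j) * 0ℚ)
    ≡⟨ cong₂ _+_ (*-identityʳ (u zero)) (∙-zeroʳ (u ∘ suc)) ⟩
  u zero + 0ℚ ≡⟨ +-identityʳ (u zero) ⟩
  u zero ∎
∙-identityʳ {suc n} u (suc i) = begin
  u zero * 0ℚ + sum (λ j → u (suc j) * identity (suc i) (suc j))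
    ≡⟨ cong₂ _+_ (*-zeroʳ (u zero)) (∙-congˡ (u ∘ suc) (identity-suc i)) ⟩
  0ℚ + (u ∘ suc) ∙ identity i ≡⟨ +-identityˡ _ ⟩
  (u ∘ suc) ∙ identity i ≡⟨ ∙-identityʳ (u ∘ suc) i ⟩
  u (suc i) ∎

∙-identityˡ : ∀ {n} (u : Vector ℚ n) i → identity i ∙ u ≡ u i
∙-identityˡ u i = trans (∙-comm (identity i) u) (∙-identityʳ u i)

-- Inequalities

*-pos : ∀ {p q} → 0ℚ < p → 0ℚ < q → 0ℚ < p * q
*-pos {p} {q} 0<p 0<q = positive⁻¹ (p * q) {{pos*pos⇒pos p {{positive 0<p}} q {{positive 0<q}}}}

*-nonNeg : ∀ {p q} → 0ℚ ≤ p → 0ℚ ≤ q → 0ℚ ≤ p * q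
*-nonNeg {p} {q} 0≤p 0≤q =
  nonNegative⁻¹ (p * q) {{nonNeg*nonNeg⇒nonNeg p {{nonNegative 0≤p}} q {{nonNegative 0≤q}}}}

+-nonNeg : ∀ {p q} → 0ℚ ≤ p → 0ℚ ≤ q → 0ℚ ≤ p + q
+-nonNeg = +-mono-≤

0<1 : 0ℚ < 1ℚ
0<1 = positive⁻¹ 1ℚ

0≤1 : 0ℚ ≤ 1ℚ
0≤1 = <⇒≤ 0<1

pos⇒neg<0 : ∀ {p} → 0ℚ < p → - p < 0ℚ
pos⇒neg<0 = neg-antimono-<

neg<0⇒pos : ∀ {p} → - p < 0ℚ → 0ℚ < p
neg<0⇒pos {p} -p<0 = subst (0ℚ <_) (solve 1 (λ p → :- (:- p) := p) refl p) (neg-antimono-< -p<0)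

sum-mono-≤ : ∀ {n} {f g : Vector ℚ n} → (∀ i → f i ≤ g i) → sum f ≤ sum g
sum-mono-≤ {zero}  f≤g = ≤-refl
sum-mono-≤ {suc n} f≤g = +-mono-≤ (f≤g zero) (sum-mono-≤ (f≤g ∘ suc))

sum-mono-< : ∀ {n} {f g : Vector ℚ n} → (∀ i → f i ≤ g i) → ∀ i → f i < g i → sum f < sum g
sum-mono-< {suc n} f≤g zero    f<g = +-mono-<-≤ f<g (sum-mono-≤ (f≤g ∘ suc))
sum-mono-< {suc n} f≤g (suc i) f<g = +-mono-≤-< (f≤g zero) (sum-mono-< (f≤g ∘ suc) i f<g)

sum-nonNeg : ∀ {n} {f : Vector ℚ n} → (∀ i → 0ℚ ≤ f i) → 0ℚ ≤ sum f
sum-nonNeg {n} {f} 0≤f = subst (_≤ sum f) (sum-zero {n} _ λ _ → refl) (sum-mono-≤ 0≤f)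

sum-neg-< : ∀ {n} {f : Vector ℚ n} → (∀ i → f i ≤ 0ℚ) → ∀ i → f i < 0ℚ → sum f < 0ℚ
sum-neg-< {n} {f} f≤0 i f<0 =
  subst (sum f <_) (sum-zero {n} _ λ _ → refl) (sum-mono-< f≤0 i f<0)

sum-nonZero-term : ∀ {n} (f : Vector ℚ n) → sum f ≢ 0ℚ → ∃[ i ] f i ≢ 0ℚ
sum-nonZero-term {zero} f Σ≢0 = ⊥-elim (Σ≢0 refl)
sum-nonZero-term {suc n} f Σ≢0 with f zero ≟ 0ℚ
... | no f₀≢0 = zero , f₀≢0
... | yes f₀≡0 =
  let i , fᵢ≢0 = sum-nonZero-term (f ∘ suc) λ Σ≡0 → Σ≢0 (cong₂ _+_ f₀≡0 Σ≡0) in suc i , fᵢ≢0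

-- Hessenberg matrices determined by a two-colouring of the columns

agree : Bool → Bool → ℚ
agree true  true  = 1ℚ
agree true  false = 0ℚ
agree false true  = 0ℚ
agree false false = 1ℚ

-- Row i has the colour e if i = 0, and the colour opposite to that of column
-- i - 1 otherwise.  On and above the diagonal an entry is 1 iff the colours of
-- its row and of its column agree.
hess : Bool → (ℕ → Bool) → ℕ → ℕ → ℚ
hess e c zero          j       = agree e (c j)
hess e c (suc i)       (suc j) = hess (not (c 0)) (c ∘ suc) i j
hess e c (suc zero)    zero    = 1ℚ
hess e c (suc (suc i)) zero    = 0ℚ

hessenberg : ∀ {n} → Bool → (ℕ → Bool) → Matrix n
hessenberg e c i j = hess e c (toℕ i) (toℕ j)

agree-01 : ∀ a b → Is01 (agree a b)
agree-01 true  true  = inj₂ refl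
agree-01 true  false = inj₁ refl
agree-01 false true  = inj₁ refl
agree-01 false false = inj₂ refl

agree-refl : ∀ a → agree a a ≡ 1ℚ
agree-refl true  = refl
agree-refl false = refl

agree-≢ : ∀ {a b} → a ≢ b → agree a b ≡ 0ℚ
agree-≢ {true}  {true}  a≢b = ⊥-elim (a≢b refl)
agree-≢ {true}  {false} a≢b = refl
agree-≢ {false} {true}  a≢b = refl
agree-≢ {false} {false} a≢b = ⊥-elim (a≢b refl)

agree-not-self : ∀ a → agree a (not a) ≡ 0ℚ
agree-not-self true  = refl
agree-not-self false = refl

agree-not-≢ : ∀ {a b} → a ≢ b → agree (not a) b ≡ 1ℚ
agree-not-≢ {a} {b} a≢b = trans (cong (λ x → agree x b) (sym (Bool.¬-not (a≢b ∘ sym)))) (agree-refl b)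

agree-notˡ-self : ∀ a → agree (not a) a ≡ 0ℚ
agree-notˡ-self true  = refl
agree-notˡ-self false = refl

agree-notˡ : ∀ a b → agree (not a) b ≡ agree a (not b)
agree-notˡ true  true  = refl
agree-notˡ true  false = refl
agree-notˡ false true  = refl
agree-notˡ false false = refl

agree-not-not : ∀ a b → agree (not a) (not b) ≡ agree a b
agree-not-not true  true  = refl
agree-not-not true  false = refl
agree-not-not false true  = refl
agree-not-not false false = refl

agree-comm : ∀ a b → agree a b ≡ agree b a
agree-comm true  true  = refl
agree-comm true  false = refl
agree-comm false true  = refl
agree-comm false false = refl

agree-nonNeg : ∀ a b → 0ℚ ≤ agree a b
agree-nonNeg true  true  = 0≤1
agree-nonNeg true  false = ≤-refl
agree-nonNeg false true  = ≤-refl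
agree-nonNeg false false = 0≤1

agree-idem : ∀ a b → agree a b * agree a b ≡ agree a b
agree-idem true  true  = refl
agree-idem true  false = refl
agree-idem false true  = refl
agree-idem false false = refl

agree-*-≢ : ∀ a {x y} → x ≢ y → agree a x * agree a y ≡ 0ℚ
agree-*-≢ a {x} {y} x≢y with a Bool.≟ x
... | yes refl = trans (cong (agree a a *_) (agree-≢ x≢y)) (*-zeroʳ (agree a a))
... | no a≢x = trans (cong (_* agree a y) (agree-≢ a≢x)) (*-zeroˡ (agree a y))

-- If `x` and `y` are equal, exactly one of the two products is 1; if they differ, only the last
-- term is 1. This is the origin of the all-ones summand of the Gramian.
agree-total : ∀ a x y →
  agree a x * agree a y + (agree (not a) x * agree (not a) y + agree x (not y)) ≡ 1ℚ
agree-total true  true  true  = refl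
agree-total true  true  false = refl
agree-total true  false true  = refl
agree-total true  false false = refl
agree-total false true  true  = refl
agree-total false true  false = refl
agree-total false false true  = refl
agree-total false false false = refl

-- Gramians

extend : ∀ {n} → Matrix n → Matrix (suc n)
extend W zero    zero    = 1ℚ
extend W zero    (suc j) = 0ℚ
extend W (suc i) zero    = 0ℚ
extend W (suc i) (suc j) = W i j

addOuter : ∀ {n} → Vector ℚ n → Matrix n → Matrix n
addOuter u W i j = u i * u j + W i j

indicator : ∀ {n} → Bool → (ℕ → Bool) → Vector ℚ n
indicator e c i = agree e (c (toℕ i))

-- The contribution of the rows after the first to those entries of the Gramian
-- that belong to two columns of the same colour.
sameColour : (ℕ → Bool) → ∀ n → Matrix n
sameColour c 0 = λ ()
sameColour c 1 = λ _ _ → 0ℚ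
sameColour c (suc (suc n)) =
  extend (addOuter (indicator (not (c 0)) (c ∘ suc)) (sameColour (c ∘ suc) (suc n)))

-- Two columns of different colours have exactly one common 1 below row 0, in the row of the
-- subdiagonal entry of the earlier column; this gives the second summand. The last column has no
-- subdiagonal entry, which is why `sameColour` starts from the zero matrix of size 1.
gram-lowerRows : ∀ e c n (i j : Fin (suc n)) →
  sum {n} (λ r → hess e c (suc (toℕ r)) (toℕ i) * hess e c (suc (toℕ r)) (toℕ j)) ≡
  sameColour c (suc n) i j + agree (c (toℕ i)) (not (c (toℕ j)))
gram-lowerRows e c zero zero zero = sym (trans (+-identityˡ _) (agree-not-self (c 0)))
gram-lowerRows e c (suc n) zero zero = cong₂ _+_ {1ℚ * 1ℚ} {1ℚ} refl
  (trans (∙-zeroˡ {n} λ _ → 0ℚ) (sym (agree-not-self (c 0))))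
gram-lowerRows e c (suc n) zero (suc j) = begin
  1ℚ * agree (not (c 0)) cⱼ + sum (λ r → 0ℚ * row r)
    ≡⟨ cong₂ _+_ (*-identityˡ (agree (not (c 0)) cⱼ)) (∙-zeroˡ row) ⟩
  agree (not (c 0)) cⱼ + 0ℚ ≡⟨ +-comm (agree (not (c 0)) cⱼ) 0ℚ ⟩
  0ℚ + agree (not (c 0)) cⱼ ≡⟨ cong (λ ξ → 0ℚ + ξ) (agree-notˡ (c 0) cⱼ) ⟩
  0ℚ + agree (c 0) (not cⱼ) ∎
  where
  cⱼ = c (suc (toℕ j))
  row : Vector ℚ n
  row r = hess (not (c 0)) (c ∘ suc) (suc (toℕ r)) (toℕ j)
gram-lowerRows e c (suc n) (suc i) zero = begin
  agree (not (c 0)) cᵢ * 1ℚ + sum (λ r → row r * 0ℚ)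
    ≡⟨ cong₂ _+_ (*-identityʳ (agree (not (c 0)) cᵢ)) (∙-zeroʳ row) ⟩
  agree (not (c 0)) cᵢ + 0ℚ ≡⟨ +-comm (agree (not (c 0)) cᵢ) 0ℚ ⟩
  0ℚ + agree (not (c 0)) cᵢ ≡⟨ cong (λ ξ → 0ℚ + ξ) (agree-comm (not (c 0)) cᵢ) ⟩
  0ℚ + agree cᵢ (not (c 0)) ∎
  where
  cᵢ = c (suc (toℕ i))
  row : Vector ℚ n
  row r = hess (not (c 0)) (c ∘ suc) (suc (toℕ r)) (toℕ i)
gram-lowerRows e c (suc n) (suc i) (suc j) = begin
  a * b + sum {n} _ ≡⟨ cong (λ ξ → a * b + ξ) (gram-lowerRows (not (c 0)) (c ∘ suc) n i j) ⟩
  a * b + (s + x) ≡⟨ +-assoc (a * b) s x ⟨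
  a * b + s + x ∎
  where
  a = agree (not (c 0)) (c (suc (toℕ i)))
  b = agree (not (c 0)) (c (suc (toℕ j)))
  s = sameColour (c ∘ suc) (suc n) i j
  x = agree (c (suc (toℕ i))) (not (c (suc (toℕ j))))

-- The first row and the first row of the opposite colour contribute, together
-- with the entries for columns of different colours, the all-ones matrix.
gram-hessenberg : ∀ c n (i j : Fin (suc (suc n))) →
  gram (hessenberg (c 0) c) i j ≡
  addOuter (λ _ → 1ℚ) (extend (sameColour (c ∘ suc) (suc n))) i j
gram-hessenberg c n i j =
  trans (cong (λ ξ → agree (c 0) (c (toℕ i)) * agree (c 0) (c (toℕ j)) + ξ)
          (gram-lowerRows (c 0) c (suc n) i j))
        (entry i j)
  where
  entry : ∀ i j →
    agree (c 0) (c (toℕ i)) * agree (c 0) (c (toℕ j)) +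
      (sameColour c (suc (suc n)) i j + agree (c (toℕ i)) (not (c (toℕ j)))) ≡
    1ℚ * 1ℚ + extend (sameColour (c ∘ suc) (suc n)) i j
  entry zero zero with c 0
  ... | true  = refl
  ... | false = refl
  entry zero (suc j) with c 0 | c (suc (toℕ j))
  ... | true  | true  = refl
  ... | true  | false = refl
  ... | false | true  = refl
  ... | false | false = refl
  entry (suc i) zero with c 0 | c (suc (toℕ i))
  ... | true  | true  = refl
  ... | true  | false = refl
  ... | false | true  = refl
  ... | false | false = refl
  entry (suc i) (suc j) = begin
    p + (q + s + x) ≡⟨ solve 4 (λ p q s x → p :+ (q :+ s :+ x) := p :+ (q :+ x) :+ s) refl p q s x ⟩
    p + (q + x) + s ≡⟨ cong (_+ s) (agree-total (c 0) cᵢ cⱼ) ⟩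
    1ℚ + s ∎
    where
    cᵢ = c (suc (toℕ i))
    cⱼ = c (suc (toℕ j))
    p = agree (c 0) cᵢ * agree (c 0) cⱼ
    q = agree (not (c 0)) cᵢ * agree (not (c 0)) cⱼ
    s = sameColour (c ∘ suc) (suc n) i j
    x = agree cᵢ (not cⱼ)

-- Strict ultrametricity

-- The invariant of both operations. `separate` makes `W` block diagonal with respect to the
-- colours, so that an outer product of colour indicators shifts a whole block by a constant;
-- `0<diagonal` keeps the diagonal strictly dominant next to the zeros that `extend` creates.
record IsColourUltrametric {n} (c : Fin n → Bool) (W : Matrix n) : Set where
  field
    symmetric  : ∀ i j → W i j ≡ W j i
    0≤entry    : ∀ i j → 0ℚ ≤ W i j
    0<diagonal : ∀ i → 0ℚ < W i i
    separate   : ∀ i j → c i ≢ c j → W i j ≡ 0ℚ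
    ultra      : ∀ i j k → W i k ≤ W i j ⊎ W k j ≤ W i j
    diagonal   : ∀ i j → i ≢ j → W i j < W i i

extend-ultrametric : ∀ {n} {c : Fin (suc n) → Bool} {W : Matrix n} →
  IsColourUltrametric (c ∘ suc) W → IsColourUltrametric c (extend W)
extend-ultrametric {n} {c} {W} U = record
  { symmetric = symmetric′ ; 0≤entry = 0≤entry′ ; 0<diagonal = 0<diagonal′
  ; separate = separate′ ; ultra = ultra′ ; diagonal = diagonal′ }
  where
  open IsColourUltrametric U
  symmetric′ : ∀ i j → extend W i j ≡ extend W j i
  symmetric′ zero    zero    = refl
  symmetric′ zero    (suc j) = refl
  symmetric′ (suc i) zero    = refl
  symmetric′ (suc i) (suc j) = symmetric i j
  0≤entry′ : ∀ i j → 0ℚ ≤ extend W i j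
  0≤entry′ zero    zero    = 0≤1
  0≤entry′ zero    (suc j) = ≤-refl
  0≤entry′ (suc i) zero    = ≤-refl
  0≤entry′ (suc i) (suc j) = 0≤entry i j
  0<diagonal′ : ∀ i → 0ℚ < extend W i i
  0<diagonal′ zero    = 0<1
  0<diagonal′ (suc i) = 0<diagonal i
  separate′ : ∀ i j → c i ≢ c j → extend W i j ≡ 0ℚ
  separate′ zero    zero    c≢c = ⊥-elim (c≢c refl)
  separate′ zero    (suc j) _   = refl
  separate′ (suc i) zero    _   = refl
  separate′ (suc i) (suc j) c≢c = separate i j c≢c
  ultra′ : ∀ i j k → extend W i k ≤ extend W i j ⊎ extend W k j ≤ extend W i j
  ultra′ zero    j       zero    = inj₂ ≤-refl
  ultra′ zero    zero    (suc k) = inj₁ 0≤1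
  ultra′ zero    (suc j) (suc k) = inj₁ ≤-refl
  ultra′ (suc i) j       zero    = inj₁ (0≤entry′ (suc i) j)
  ultra′ (suc i) zero    (suc k) = inj₂ ≤-refl
  ultra′ (suc i) (suc j) (suc k) = ultra i j k
  diagonal′ : ∀ i j → i ≢ j → extend W i j < extend W i i
  diagonal′ zero    zero    i≢j = ⊥-elim (i≢j refl)
  diagonal′ zero    (suc j) _   = 0<1
  diagonal′ (suc i) zero    _   = 0<diagonal i
  diagonal′ (suc i) (suc j) i≢j = diagonal i j (i≢j ∘ cong suc)

-- The outer product is 1 on the block of colour `e` and 0 elsewhere. Comparisons within a block are
-- therefore unchanged, and entries between colours remain 0, the least possible value.
addOuter-ultrametric : ∀ {n} {c : Fin n → Bool} {W : Matrix n} e →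
  IsColourUltrametric c W → IsColourUltrametric c (addOuter (agree e ∘ c) W)
addOuter-ultrametric {n} {c} {W} e U = record
  { symmetric = λ i j → cong₂ _+_ (*-comm (a i) (a j)) (symmetric i j)
  ; 0≤entry = 0≤entry′ ; 0<diagonal = λ i → +-mono-≤-< (0≤aa i i) (0<diagonal i)
  ; separate = separate′ ; ultra = ultra′ ; diagonal = diagonal′ }
  where
  open IsColourUltrametric U
  a : Vector ℚ n
  a = agree e ∘ c
  W′ : Matrix n
  W′ = addOuter a W
  0≤aa : ∀ i j → 0ℚ ≤ a i * a j
  0≤aa i j = *-nonNeg (agree-nonNeg e (c i)) (agree-nonNeg e (c j))
  0≤entry′ : ∀ i j → 0ℚ ≤ W′ i j
  0≤entry′ i j = +-nonNeg (0≤aa i j) (0≤entry i j)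
  separate′ : ∀ i j → c i ≢ c j → W′ i j ≡ 0ℚ
  separate′ i j c≢c = cong₂ _+_ (agree-*-≢ e c≢c) (separate i j c≢c)
  ultra′ : ∀ i j k → W′ i k ≤ W′ i j ⊎ W′ k j ≤ W′ i j
  ultra′ i j k with c i Bool.≟ c k | c k Bool.≟ c j
  ... | no ci≢ck | _ = inj₁ (subst (_≤ W′ i j) (sym (separate′ i k ci≢ck)) (0≤entry′ i j))
  ... | yes _ | no ck≢cj = inj₂ (subst (_≤ W′ i j) (sym (separate′ k j ck≢cj)) (0≤entry′ i j))
  ... | yes ci≡ck | yes ck≡cj = Sum.map
    (+-mono-≤ (≤-reflexive (cong (λ x → a i * agree e x) ck≡cj)))
    (+-mono-≤ (≤-reflexive (cong (λ x → agree e x * a j) (sym ci≡ck))))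
    (ultra i j k)
  diagonal′ : ∀ i j → i ≢ j → W′ i j < W′ i i
  diagonal′ i j i≢j with c i Bool.≟ c j
  ... | yes ci≡cj = +-mono-≤-<
    (≤-reflexive (cong (λ x → a i * agree e x) (sym ci≡cj))) (diagonal i j i≢j)
  ... | no ci≢cj = subst (_< W′ i i) (sym (separate′ i j ci≢cj))
    (+-mono-≤-< (0≤aa i i) (0<diagonal i))

unit-ultrametric : ∀ {c : Fin 1 → Bool} {W : Matrix 1} → W zero zero ≡ 1ℚ →
  IsColourUltrametric c W
unit-ultrametric {c} {W} W≡1 = record
  { symmetric = λ { zero zero → refl } ; 0≤entry = λ { zero zero → <⇒≤ 0<W }
  ; 0<diagonal = λ { zero → 0<W } ; separate = λ { zero zero c≢c → ⊥-elim (c≢c refl) }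
  ; ultra = λ { zero zero zero → inj₁ ≤-refl } ; diagonal = λ { zero zero i≢j → ⊥-elim (i≢j refl) } }
  where
  0<W : 0ℚ < W zero zero
  0<W = subst (0ℚ <_) (sym W≡1) 0<1

-- The base of the induction over the columns: the entry of the last column is 1 rather than 0
-- exactly because the row attached to the preceding column agrees with it in colour. Here the
-- distinctness of the last two colours enters.
outer-unit : ∀ (c : ℕ → Bool) → c 0 ≢ c 1 →
  addOuter (indicator (not (c 0)) (c ∘ suc)) (sameColour (c ∘ suc) 1) zero zero ≡ 1ℚ
outer-unit c c≢c = cong (λ x → x * x + 0ℚ) (agree-not-≢ c≢c)

sameColour-ultrametric : ∀ c n → c n ≢ c (suc n) →
  IsColourUltrametric (c ∘ toℕ) (sameColour c (suc (suc n)))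
sameColour-ultrametric c zero    c≢c =
  extend-ultrametric (unit-ultrametric (outer-unit c c≢c))
sameColour-ultrametric c (suc n) c≢c =
  extend-ultrametric (addOuter-ultrametric (not (c 0)) (sameColour-ultrametric (c ∘ suc) n c≢c))

-- Inverses

-- Off-diagonal entries are only weakly negative, since those between colours vanish. Positive row
-- sums make the Sherman-Morrison corrections have a definite sign.
record HasColourInverse {n} (c : Fin n → Bool) (W : Matrix n) : Set where
  field
    inverse       : Matrix n
    symmetric     : ∀ i j → inverse i j ≡ inverse j i
    isInverse     : ∀ i j → W i ∙ inverse j ≡ identity i j
    separate      : ∀ i j → c i ≢ c j → inverse i j ≡ 0ℚ
    offDiagonal≤0 : ∀ i j → i ≢ j → inverse i j ≤ 0ℚ
    0<rowSum      : ∀ i → 0ℚ < sum (inverse i)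

extend-inverse : ∀ {n} {c : Fin (suc n) → Bool} {W : Matrix n} →
  HasColourInverse (c ∘ suc) W → HasColourInverse c (extend W)
extend-inverse {n} {c} {W} I = record
  { inverse = extend V ; symmetric = symmetric′ ; isInverse = isInverse′
  ; separate = separate′ ; offDiagonal≤0 = offDiagonal≤0′ ; 0<rowSum = 0<rowSum′ }
  where
  open HasColourInverse I renaming (inverse to V)
  symmetric′ : ∀ i j → extend V i j ≡ extend V j i
  symmetric′ zero    zero    = refl
  symmetric′ zero    (suc j) = refl
  symmetric′ (suc i) zero    = refl
  symmetric′ (suc i) (suc j) = symmetric i j
  isInverse′ : ∀ i j → extend W i ∙ extend V j ≡ identity i j
  isInverse′ zero    zero    = cong (λ ξ → 1ℚ * 1ℚ + ξ) (∙-zeroˡ {n} λ _ → 0ℚ)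
  isInverse′ zero    (suc j) = cong (λ ξ → 1ℚ * 0ℚ + ξ) (∙-zeroˡ (V j))
  isInverse′ (suc i) zero    = cong (λ ξ → 0ℚ * 1ℚ + ξ) (∙-zeroʳ (W i))
  isInverse′ (suc i) (suc j) = begin
    0ℚ * 0ℚ + W i ∙ V j           ≡⟨ +-identityˡ (W i ∙ V j) ⟩
    W i ∙ V j                     ≡⟨ isInverse i j ⟩
    identity i j                  ≡⟨ identity-suc i j ⟨
    identity (suc i) (suc j)      ∎
  separate′ : ∀ i j → c i ≢ c j → extend V i j ≡ 0ℚ
  separate′ zero    zero    c≢c = ⊥-elim (c≢c refl)
  separate′ zero    (suc j) _   = refl
  separate′ (suc i) zero    _   = refl
  separate′ (suc i) (suc j) c≢c = separate i j c≢c
  offDiagonal≤0′ : ∀ i j → i ≢ j → extend V i j ≤ 0ℚ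
  offDiagonal≤0′ zero    zero    i≢j = ⊥-elim (i≢j refl)
  offDiagonal≤0′ zero    (suc j) _   = ≤-refl
  offDiagonal≤0′ (suc i) zero    _   = ≤-refl
  offDiagonal≤0′ (suc i) (suc j) i≢j = offDiagonal≤0 i j (i≢j ∘ cong suc)
  0<rowSum′ : ∀ i → 0ℚ < sum (extend V i)
  0<rowSum′ zero    = subst (λ x → 0ℚ < 1ℚ + x) (sym (sum-zero {n} _ λ _ → refl)) 0<1
  0<rowSum′ (suc i) = subst (0ℚ <_) (sym (+-identityˡ (sum (V i)))) (0<rowSum i)

reciprocal : ∀ {p} → 0ℚ < p → ∃[ t ] 0ℚ < t × t * p ≡ 1ℚ
reciprocal {p} 0<p =
  1/p , positive⁻¹ 1/p {{1/pos⇒pos p {{positive 0<p}}}} , *-inverseˡ p {{p≢0}}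
  where
  p≢0 : ℚ.NonZero p
  p≢0 = pos⇒nonZero p {{positive 0<p}}
  1/p : ℚ
  1/p = (1/ p) {{p≢0}}

-- The vector `y` and the scalar `t` are parameters with defining equations, because each
-- application knows `V u` in a closed form from which its signs can be read off.
module ShermanMorrison {n} (W V : Matrix n) (u y : Vector ℚ n)
  (symmetric : ∀ i j → V i j ≡ V j i) (isInverse : ∀ i j → W i ∙ V j ≡ identity i j)
  (Vu≡y : ∀ i → V i ∙ u ≡ y i) (t : ℚ) (t[1+uy]≡1 : t * (1ℚ + u ∙ y) ≡ 1ℚ) where

  updated : Matrix n
  updated i j = V i j + - (t * y i) * y j

  updated-symmetric : ∀ i j → updated i j ≡ updated j i
  updated-symmetric i j = cong₂ _+_ (symmetric i j)
    (solve 3 (λ t a b → :- (t :* a) :* b := :- (t :* b) :* a) refl t (y i) (y j))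

  Wy≡u : ∀ i → W i ∙ y ≡ u i
  Wy≡u i = begin
    W i ∙ y                              ≡⟨ ∙-congˡ (W i) (λ k → sym (Vu≡y k)) ⟩
    W i ∙ (λ k → V k ∙ u)                ≡⟨ ∙-assoc (W i) V u ⟨
    (λ j → W i ∙ (λ k → V k j)) ∙ u      ≡⟨ ∙-congʳ u (λ j → ∙-congˡ (W i) λ k → symmetric k j) ⟩
    (λ j → W i ∙ V j) ∙ u                ≡⟨ ∙-congʳ u (isInverse i) ⟩
    identity i ∙ u                       ≡⟨ ∙-identityˡ u i ⟩
    u i                                  ∎

  updated-∙ : ∀ j (v : Vector ℚ n) → v ∙ updated j ≡ v ∙ V j + - (t * y j) * (v ∙ y)
  updated-∙ j v = trans (∙-distribˡ-+ v (V j) _) (cong (λ ξ → v ∙ V j + ξ) (∙-scaleʳ (- (t * y j)) v y))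

  updated-sum : ∀ i → sum (updated i) ≡ sum (V i) + - (t * y i) * sum y
  updated-sum i = trans (∑-distrib-+ (V i) λ j → - (t * y i) * y j)
    (cong (λ ξ → sum (V i) + ξ) (sym (*-distribˡ-sum (- (t * y i)) y)))

  addOuter-∙ : ∀ i (v : Vector ℚ n) → addOuter u W i ∙ v ≡ u i * (u ∙ v) + W i ∙ v
  addOuter-∙ i v = begin
    addOuter u W i ∙ v                     ≡⟨ ∙-comm (addOuter u W i) v ⟩
    v ∙ addOuter u W i                     ≡⟨ ∙-distribˡ-+ v (λ k → u i * u k) (W i) ⟩
    v ∙ (λ k → u i * u k) + v ∙ W i        ≡⟨ cong₂ _+_ (∙-scaleʳ (u i) v u) (∙-comm v (W i)) ⟩
    u i * (v ∙ u) + W i ∙ v                ≡⟨ cong (λ x → u i * x + W i ∙ v) (∙-comm v u) ⟩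
    u i * (u ∙ v) + W i ∙ v                ∎

  updated-isInverse : ∀ i j → addOuter u W i ∙ updated j ≡ identity i j
  updated-isInverse i j = begin
    addOuter u W i ∙ updated j
      ≡⟨ addOuter-∙ i (updated j) ⟩
    u i * (u ∙ updated j) + W i ∙ updated j
      ≡⟨ cong₂ (λ a b → u i * a + b) (updated-∙ j u) (updated-∙ j (W i)) ⟩
    u i * (u ∙ V j + - (t * y j) * (u ∙ y)) + (W i ∙ V j + - (t * y j) * (W i ∙ y))
      ≡⟨ cong₂ (λ a b → u i * (a + - (t * y j) * (u ∙ y)) + b)
           (trans (∙-comm u (V j)) (Vu≡y j))
           (cong₂ (λ a b → a + - (t * y j) * b) (isInverse i j) (Wy≡u i)) ⟩
    u i * (y j + - (t * y j) * (u ∙ y)) + (identity i j + - (t * y j) * u i)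
      ≡⟨ solve 5 (λ a b t s d → a :* (b :+ :- (t :* b) :* s) :+ (d :+ :- (t :* b) :* a)
                   := d :+ a :* b :* (con 1ℚ :- t :* (con 1ℚ :+ s)))
           refl (u i) (y j) t (u ∙ y) (identity i j) ⟩
    identity i j + u i * y j * (1ℚ - t * (1ℚ + u ∙ y))
      ≡⟨ cong (λ x → identity i j + u i * y j * (1ℚ - x)) t[1+uy]≡1 ⟩
    identity i j + u i * y j * 0ℚ
      ≡⟨ solve 2 (λ d b → d :+ b :* con 0ℚ := d) refl (identity i j) (u i * y j) ⟩
    identity i j ∎

-- As `V` does not mix colours, the factor `a` moves through it, and `V a` is the vector of row sums
-- restricted to colour `e`. It is nonnegative, so the correction only lowers entries, and only
-- within that colour. A row sum `r` of colour `e` becomes `t * r`; the others stay as they are.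
addOuter-inverse : ∀ {n} {c : Fin n → Bool} {W : Matrix n} e →
  HasColourInverse c W → HasColourInverse c (addOuter (agree e ∘ c) W)
addOuter-inverse {n} {c} {W} e I = record
  { inverse = updated ; symmetric = updated-symmetric ; isInverse = updated-isInverse
  ; separate = separate′ ; offDiagonal≤0 = offDiagonal≤0′ ; 0<rowSum = 0<rowSum′ }
  where
  open HasColourInverse I renaming (inverse to V)
  a ρ y : Vector ℚ n
  a = agree e ∘ c
  ρ = sum ∘ V
  y i = a i * ρ i
  0≤y : ∀ i → 0ℚ ≤ y i
  0≤y i = *-nonNeg (agree-nonNeg e (c i)) (<⇒≤ (0<rowSum i))
  moved : ∀ i j → V i j * a j ≡ a i * V i j
  moved i j with c i Bool.≟ c j
  ... | yes ci≡cj = trans (*-comm (V i j) (a j)) (cong (λ x → agree e x * V i j) (sym ci≡cj))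
  ... | no ci≢cj rewrite separate i j ci≢cj = trans (*-zeroˡ (a j)) (sym (*-zeroʳ (a i)))
  Va≡y : ∀ i → V i ∙ a ≡ y i
  Va≡y i = trans (sum-cong-≗ (moved i)) (sym (*-distribˡ-sum (a i) (V i)))
  ay≡Σy : a ∙ y ≡ sum y
  ay≡Σy = sum-cong-≗ λ i → trans (sym (*-assoc (a i) (a i) (ρ i))) (cong (_* ρ i) (agree-idem e (c i)))
  s : ℚ
  s = a ∙ y
  recip : ∃[ t ] 0ℚ < t × t * (1ℚ + s) ≡ 1ℚ
  recip = reciprocal (+-mono-<-≤ 0<1 (subst (0ℚ ≤_) (sym ay≡Σy) (sum-nonNeg 0≤y)))
  t : ℚ
  t = proj₁ recip
  0<t : 0ℚ < t
  0<t = proj₁ (proj₂ recip)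
  t[1+s]≡1 : t * (1ℚ + s) ≡ 1ℚ
  t[1+s]≡1 = proj₂ (proj₂ recip)
  open ShermanMorrison W V a y symmetric isInverse Va≡y t t[1+s]≡1
  yy≡0 : ∀ {i j} → c i ≢ c j → y i * y j ≡ 0ℚ
  yy≡0 {i} {j} ci≢cj = begin
    a i * ρ i * (a j * ρ j)
      ≡⟨ solve 4 (λ a r b q → a :* r :* (b :* q) := a :* b :* (r :* q)) refl (a i) (ρ i) (a j) (ρ j) ⟩
    a i * a j * (ρ i * ρ j) ≡⟨ cong (_* (ρ i * ρ j)) (agree-*-≢ e ci≢cj) ⟩
    0ℚ * (ρ i * ρ j)        ≡⟨ *-zeroˡ (ρ i * ρ j) ⟩
    0ℚ                      ∎
  regroup : ∀ i j → - (t * y i) * y j ≡ - (t * (y i * y j))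
  regroup i j = solve 3 (λ t a b → :- (t :* a) :* b := :- (t :* (a :* b))) refl t (y i) (y j)
  separate′ : ∀ i j → c i ≢ c j → updated i j ≡ 0ℚ
  separate′ i j ci≢cj = cong₂ _+_ (separate i j ci≢cj)
    (trans (regroup i j) (trans (cong (λ x → - (t * x)) (yy≡0 ci≢cj)) (cong -_ (*-zeroʳ t))))
  offDiagonal≤0′ : ∀ i j → i ≢ j → updated i j ≤ 0ℚ
  offDiagonal≤0′ i j i≢j = +-mono-≤ (offDiagonal≤0 i j i≢j)
    (subst (_≤ 0ℚ) (sym (regroup i j))
      (neg-antimono-≤ (*-nonNeg (<⇒≤ 0<t) (*-nonNeg (0≤y i) (0≤y j)))))
  rowSum : ∀ b r → Is01 b → 0ℚ < r → 0ℚ < r + - (t * (b * r)) * s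
  rowSum b r (inj₁ refl) 0<r = subst (0ℚ <_)
    (solve 3 (λ r t s → r := r :+ :- (t :* (con 0ℚ :* r)) :* s) refl r t s) 0<r
  rowSum b r (inj₂ refl) 0<r = subst (0ℚ <_) (begin
    t * r ≡⟨ solve 3 (λ t r s → t :* r := t :* (con 1ℚ :+ s) :* r :+ :- (t :* r) :* s) refl t r s ⟩
    t * (1ℚ + s) * r + - (t * r) * s   ≡⟨ cong (λ x → x * r + - (t * r) * s) t[1+s]≡1 ⟩
    1ℚ * r + - (t * r) * s
      ≡⟨ solve 3 (λ t r s → con 1ℚ :* r :+ :- (t :* r) :* s := r :+ :- (t :* (con 1ℚ :* r)) :* s) refl t r s ⟩
    r + - (t * (1ℚ * r)) * s ∎) (*-pos 0<t 0<r)
  0<rowSum′ : ∀ i → 0ℚ < sum (updated i)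
  0<rowSum′ i = subst (0ℚ <_)
    (sym (trans (updated-sum i) (cong (λ x → ρ i + - (t * y i) * x) (sym ay≡Σy))))
    (rowSum (a i) (ρ i) (agree-01 e (c i)) (0<rowSum i))

unit-inverse : ∀ {c : Fin 1 → Bool} {W : Matrix 1} → W zero zero ≡ 1ℚ → HasColourInverse c W
unit-inverse {c} {W} W≡1 = record
  { inverse = λ _ _ → 1ℚ ; symmetric = λ _ _ → refl
  ; isInverse = λ { zero zero → cong (λ x → x * 1ℚ + 0ℚ) W≡1 }
  ; separate = λ { zero zero c≢c → ⊥-elim (c≢c refl) }
  ; offDiagonal≤0 = λ { zero zero i≢j → ⊥-elim (i≢j refl) } ; 0<rowSum = λ _ → 0<1 }

sameColour-inverse : ∀ c n → c n ≢ c (suc n) →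
  HasColourInverse (c ∘ toℕ) (sameColour c (suc (suc n)))
sameColour-inverse c zero    c≢c = extend-inverse (unit-inverse (outer-unit c c≢c))
sameColour-inverse c (suc n) c≢c =
  extend-inverse (addOuter-inverse (not (c 0)) (sameColour-inverse (c ∘ suc) n c≢c))

-- Adding a positive multiple of the all-ones matrix makes the off-diagonal
-- entries of the inverse strictly negative.
acuteInverse : ∀ {n} {c : Fin n → Bool} {W G : Matrix n} → HasColourInverse c W →
  (∀ i j → W i j ≡ W j i) → (∀ i j → G i j ≡ addOuter (λ _ → 1ℚ) W i j) → HasAcuteInverse G
acuteInverse {n} {c} {W} {G} I W-symmetric G≗ = record
  { inverse = updated
  ; isInverse = record { inverseˡ = left ; inverseʳ = right }
  ; offDiagonal<0 = offDiagonal<0′ ; rowSum>0 = rowSum>0′ }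
  where
  open HasColourInverse I renaming (inverse to V)
  one ρ : Vector ℚ n
  one _ = 1ℚ
  ρ = sum ∘ V
  s : ℚ
  s = one ∙ ρ
  s≡Σρ : s ≡ sum ρ
  s≡Σρ = sum-cong-≗ λ i → *-identityˡ (ρ i)
  recip : ∃[ t ] 0ℚ < t × t * (1ℚ + s) ≡ 1ℚ
  recip = reciprocal (+-mono-<-≤ 0<1
    (subst (0ℚ ≤_) (sym s≡Σρ) (sum-nonNeg λ i → <⇒≤ (0<rowSum i))))
  t : ℚ
  t = proj₁ recip
  0<t : 0ℚ < t
  0<t = proj₁ (proj₂ recip)
  t[1+s]≡1 : t * (1ℚ + s) ≡ 1ℚ
  t[1+s]≡1 = proj₂ (proj₂ recip)
  open ShermanMorrison W V one ρ symmetric isInverse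
    (λ i → sum-cong-≗ λ j → *-identityʳ (V i j)) t t[1+s]≡1
  right : ∀ i j → (G ⊗ updated) i j ≡ identity i j
  right i j = begin
    G i ∙ (λ k → updated k j)             ≡⟨ ∙-congʳ (λ k → updated k j) (G≗ i) ⟩
    addOuter one W i ∙ (λ k → updated k j) ≡⟨ ∙-congˡ (addOuter one W i) (λ k → updated-symmetric k j) ⟩
    addOuter one W i ∙ updated j          ≡⟨ updated-isInverse i j ⟩
    identity i j                          ∎
  left : ∀ i j → (updated ⊗ G) i j ≡ identity i j
  left i j = begin
    updated i ∙ (λ k → G k j)
      ≡⟨ ∙-congˡ (updated i) (λ k → trans (G≗ k j) (cong (λ ξ → 1ℚ * 1ℚ + ξ) (W-symmetric k j))) ⟩
    updated i ∙ addOuter one W j ≡⟨ ∙-comm (updated i) (addOuter one W j) ⟩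
    addOuter one W j ∙ updated i ≡⟨ updated-isInverse j i ⟩
    identity j i ≡⟨ identity-sym j i ⟩
    identity i j ∎
  offDiagonal<0′ : ∀ i j → i ≢ j → updated i j < 0ℚ
  offDiagonal<0′ i j i≢j = +-mono-≤-< (offDiagonal≤0 i j i≢j)
    (subst (_< 0ℚ) (solve 3 (λ t a b → :- (t :* (a :* b)) := :- (t :* a) :* b) refl t (ρ i) (ρ j))
      (pos⇒neg<0 (*-pos 0<t (*-pos (0<rowSum i) (0<rowSum j)))))
  rowSum>0′ : ∀ i → 0ℚ < sum (updated i)
  rowSum>0′ i = subst (0ℚ <_) (begin
    t * ρ i
      ≡⟨ solve 3 (λ t r s → t :* r := t :* (con 1ℚ :+ s) :* r :+ :- (t :* r) :* s) refl t (ρ i) s ⟩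
    t * (1ℚ + s) * ρ i + - (t * ρ i) * s
      ≡⟨ cong₂ (λ x z → x * ρ i + - (t * ρ i) * z) t[1+s]≡1 s≡Σρ ⟩
    1ℚ * ρ i + - (t * ρ i) * sum ρ        ≡⟨ cong (_+ - (t * ρ i) * sum ρ) (*-identityˡ (ρ i)) ⟩
    ρ i + - (t * ρ i) * sum ρ             ≡⟨ updated-sum i ⟨
    sum (updated i) ∎) (*-pos 0<t (0<rowSum i))

reduced-ultrametric : ∀ c n → c (suc n) ≢ c (suc (suc n)) →
  IsColourUltrametric (c ∘ toℕ) (extend (sameColour (c ∘ suc) (suc (suc n))))
reduced-ultrametric c n c≢c = extend-ultrametric (sameColour-ultrametric (c ∘ suc) n c≢c)

hessenberg-acuteInverse : ∀ c n → c (suc n) ≢ c (suc (suc n)) → ∀ {G : Matrix (suc (suc (suc n)))} →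
  (∀ i j → G i j ≡ gram (hessenberg (c 0) c) i j) → HasAcuteInverse G
hessenberg-acuteInverse c n c≢c G≗ = acuteInverse
  (extend-inverse {c = c ∘ toℕ} (sameColour-inverse (c ∘ suc) n c≢c))
  (IsColourUltrametric.symmetric (reduced-ultrametric c n c≢c))
  (λ i j → trans (G≗ i j) (gram-hessenberg c (suc n) i j))

-- Dual bases

-- Gaussian elimination of coordinate 0. If it vanishes on all vectors, vector 0 gets coefficient 0;
-- otherwise multiples of a pivot vector are subtracted from the others, whose coefficients come
-- from the recursion.
dependence : ∀ n (A : Vector (Vector ℚ n) (suc n)) →
  ∃[ c ] (∃[ i ] c i ≢ 0ℚ) × (∀ r → c ∙ (λ i → A i r) ≡ 0ℚ)
dependence zero A = (λ _ → 1ℚ) , (zero , 1≢0) , λ ()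
dependence (suc n) A with Fin.any? (λ i → ¬? (A i zero ≟ 0ℚ))
... | no ¬pivot =
  let c , (i , cᵢ≢0) , cA≡0 = dependence n (λ i r → A (suc i) (suc r)) in
  0ℚ ◂ c , (suc i , cᵢ≢0) ,
  λ { zero    → trans (∙-congˡ (0ℚ ◂ c) A₀≡0) (∙-zeroʳ (0ℚ ◂ c))
    ; (suc r) → cong₂ _+_ (*-zeroˡ (A zero (suc r))) (cA≡0 r) }
  where
  A₀≡0 : ∀ i → A i zero ≡ 0ℚ
  A₀≡0 i = decidable-stable (A i zero ≟ 0ℚ) λ A≢0 → ¬pivot (i , A≢0)
... | yes (p , a≢0) = c , (punchIn p i , λ c≡0 → c′ᵢ≢0 (trans (sym (insertAt-punchIn c′ p x i)) c≡0)) , cA≡0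
  where
  a b : ℚ
  a = A p zero
  b = (1/ a) {{≢-nonZero a≢0}}
  ba≡1 : b * a ≡ 1ℚ
  ba≡1 = *-inverseˡ a {{≢-nonZero a≢0}}
  rest : ∀ r → Vector ℚ (suc n)
  rest r k = A (punchIn p k) r
  reduced : Vector (Vector ℚ n) (suc n)
  reduced k r = rest (suc r) k + - (b * A p (suc r)) * rest zero k
  ih = dependence n reduced
  c′ : Vector ℚ (suc n)
  c′ = proj₁ ih
  i = proj₁ (proj₁ (proj₂ ih))
  c′ᵢ≢0 = proj₂ (proj₁ (proj₂ ih))
  -- The pivot's coefficient is the one that makes coordinate 0 of the combination vanish.
  x : ℚ
  x = - b * (c′ ∙ rest zero)
  c : Vector ℚ (suc (suc n))
  c = insertAt c′ p x
  split : ∀ r → c ∙ (λ i → A i r) ≡ x * A p r + c′ ∙ rest r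
  split r = trans (sum-remove {i = p} λ i → c i * A i r)
    (cong₂ _+_ (cong (_* A p r) (insertAt-lookup c′ p x))
               (∙-congʳ (rest r) (insertAt-punchIn c′ p x)))
  cA≡0 : ∀ r → c ∙ (λ i → A i r) ≡ 0ℚ
  cA≡0 zero = begin
    c ∙ (λ i → A i zero) ≡⟨ split zero ⟩
    - b * s * a + s ≡⟨ solve 3 (λ a b s → :- b :* s :* a :+ s := s :* (con 1ℚ :- b :* a)) refl a b s ⟩
    s * (1ℚ - b * a) ≡⟨ cong (λ z → s * (1ℚ - z)) ba≡1 ⟩
    s * 0ℚ ≡⟨ *-zeroʳ s ⟩
    0ℚ ∎
    where s = c′ ∙ rest zero
  cA≡0 (suc r) = begin
    c ∙ (λ i → A i (suc r)) ≡⟨ split (suc r) ⟩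
    - b * s * d + c′ ∙ rest (suc r)
      ≡⟨ solve 4 (λ b s d z → :- b :* s :* d :+ z := z :+ :- (b :* d) :* s) refl b s d (c′ ∙ rest (suc r)) ⟩
    c′ ∙ rest (suc r) + - (b * d) * s
      ≡⟨ cong (λ ξ → c′ ∙ rest (suc r) + ξ) (∙-scaleʳ (- (b * d)) c′ (rest zero)) ⟨
    c′ ∙ rest (suc r) + c′ ∙ (λ k → - (b * d) * rest zero k)
      ≡⟨ ∙-distribˡ-+ c′ (rest (suc r)) (λ k → - (b * d) * rest zero k) ⟨
    c′ ∙ (λ k → reduced k r) ≡⟨ proj₂ (proj₂ ih) r ⟩
    0ℚ ∎
    where
    s = c′ ∙ rest zero
    d = A p (suc r)

*-cancel-zero : ∀ {a x} → a ≢ 0ℚ → a * x ≡ 0ℚ → x ≡ 0ℚ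
*-cancel-zero {a} {x} a≢0 ax≡0 = begin
  x               ≡⟨ *-identityˡ x ⟨
  1ℚ * x          ≡⟨ cong (_* x) (*-inverseˡ a {{≢-nonZero a≢0}}) ⟨
  1/a * a * x     ≡⟨ *-assoc 1/a a x ⟩
  1/a * (a * x)   ≡⟨ cong (1/a *_) ax≡0 ⟩
  1/a * 0ℚ        ≡⟨ *-zeroʳ 1/a ⟩
  0ℚ ∎
  where 1/a = (1/ a) {{≢-nonZero a≢0}}

Dual : ∀ {n} (p q : Matrix n) → Set
Dual p q = ∀ i j → p i ∙ q j ≡ identity i j

-- Otherwise p and a standard basis vector would be n + 1 independent vectors.
dual-transpose : ∀ {n} (p q : Matrix n) → Dual p q → Dual (transpose p) (transpose q)
dual-transpose {n} p q dual r s = begin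
  (λ i → p i r) ∙ (λ i → q i s)
    ≡⟨ solve 2 (λ e z → z := e :+ :- (e :+ :- z)) refl (identity r s) _ ⟩
  identity r s + - (identity r s + - ((λ i → p i r) ∙ (λ i → q i s)))
    ≡⟨ cong (λ z → identity r s + - z) (*-cancel-zero c₀≢0 scaled) ⟩
  identity r s + 0ℚ ≡⟨ +-identityʳ (identity r s) ⟩
  identity r s ∎
  where
  dep = dependence n (identity s ◂ p)
  c₀ : ℚ
  c₀ = proj₁ dep zero
  c : Vector ℚ n
  c = proj₁ dep ∘ suc
  relation : ∀ r → c₀ * identity s r + c ∙ (λ i → p i r) ≡ 0ℚ
  relation = proj₂ (proj₂ dep)
  -- Pairing the dependence with `q j` isolates `c j`. All coefficients are thus multiples of `c₀`,
  -- which cannot be zero in a nontrivial dependence.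
  coefficient : ∀ j → c₀ * q j s + c j ≡ 0ℚ
  coefficient j = begin
    c₀ * q j s + c j
      ≡⟨ cong₂ _+_ (cong (c₀ *_) (sym (∙-identityʳ (q j) s))) (sym (∙-identityʳ c j)) ⟩
    c₀ * (q j ∙ identity s) + c ∙ identity j
      ≡⟨ cong₂ _+_ (sym (∙-scaleʳ c₀ (q j) (identity s)))
           (∙-congˡ c λ i → trans (identity-sym j i) (sym (dual i j))) ⟩
    q j ∙ (λ r → c₀ * identity s r) + c ∙ (λ i → p i ∙ q j)
      ≡⟨ cong (λ ξ → q j ∙ (λ r → c₀ * identity s r) + ξ)
           (trans (sym (∙-assoc c p (q j))) (∙-comm _ (q j))) ⟩
    q j ∙ (λ r → c₀ * identity s r) + q j ∙ (λ r → c ∙ (λ i → p i r))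
      ≡⟨ ∙-distribˡ-+ (q j) _ _ ⟨
    q j ∙ (λ r → c₀ * identity s r + c ∙ (λ i → p i r))
      ≡⟨ ∙-congˡ (q j) relation ⟩
    q j ∙ (λ _ → 0ℚ) ≡⟨ ∙-zeroʳ (q j) ⟩
    0ℚ ∎
  c≡ : ∀ j → c j ≡ - c₀ * q j s
  c≡ j = begin
    c j ≡⟨ solve 3 (λ a b x → x := :- a :* b :+ (a :* b :+ x)) refl c₀ (q j s) (c j) ⟩
    - c₀ * q j s + (c₀ * q j s + c j) ≡⟨ cong (λ ξ → - c₀ * q j s + ξ) (coefficient j) ⟩
    - c₀ * q j s + 0ℚ ≡⟨ +-identityʳ (- c₀ * q j s) ⟩
    - c₀ * q j s ∎
  c₀≢0 : c₀ ≢ 0ℚ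
  c₀≢0 c₀≡0 with proj₁ (proj₂ dep)
  ... | zero  , c₀≢0′ = c₀≢0′ c₀≡0
  ... | suc j , cⱼ≢0 =
    cⱼ≢0 (trans (c≡ j) (trans (cong (λ z → - z * q j s) c₀≡0) (*-zeroˡ (q j s))))
  scaled : c₀ * (identity r s + - ((λ i → p i r) ∙ (λ i → q i s))) ≡ 0ℚ
  scaled = begin
    c₀ * (identity r s + - d)
      ≡⟨ solve 3 (λ a e d → a :* (e :+ :- d) := a :* e :+ :- a :* d) refl c₀ (identity r s) d ⟩
    c₀ * identity r s + - c₀ * d
      ≡⟨ cong₂ _+_ (cong (c₀ *_) (identity-sym r s))
           (trans (cong (- c₀ *_) (∙-comm (λ i → p i r) _))
             (sym (∙-scaleˡ (- c₀) (λ i → q i s) (λ i → p i r)))) ⟩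
    c₀ * identity s r + (λ i → - c₀ * q i s) ∙ (λ i → p i r)
      ≡⟨ cong (λ ξ → c₀ * identity s r + ξ) (∙-congʳ (λ i → p i r) λ i → sym (c≡ i)) ⟩
    c₀ * identity s r + c ∙ (λ i → p i r) ≡⟨ relation r ⟩
    0ℚ ∎
    where d = (λ i → p i r) ∙ (λ i → q i s)

expansion : ∀ {n} {p q : Matrix n} → Dual p q → ∀ u s →
  u s ≡ (λ i → u ∙ p i) ∙ (λ i → q i s)
expansion {p = p} {q} dual u s = begin
  u s                                          ≡⟨ ∙-identityʳ u s ⟨
  u ∙ identity s
    ≡⟨ ∙-congˡ u (λ r → trans (identity-sym s r) (sym (dual-transpose p q dual r s))) ⟩
  u ∙ (λ r → (λ i → p i r) ∙ (λ i → q i s))    ≡⟨ ∙-assoc u (transpose p) _ ⟨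
  (λ i → u ∙ p i) ∙ (λ i → q i s)              ∎

-- Acute simplices

-- The link between the two descriptions of acuteness. Each normal is scaled to have product 1 with
-- its own vertex. Minus the sum of the normals is then an inward normal of the facet opposite the
-- origin, so its products with them are the negated row sums.
record AcuteDual {n} (p : Matrix n) : Set where
  field
    normal        : Matrix n
    dual          : Dual p normal
    offDiagonal<0 : ∀ i j → i ≢ j → normal i ∙ normal j < 0ℚ
    rowSum>0      : ∀ i → 0ℚ < sum (λ j → normal i ∙ normal j)

-- The columns of `P` times the inverse Gramian form the basis dual to the columns of `P`. They are
-- inward normals, and their own Gramian is the inverse Gramian, up to transposition.
acuteInverse⇒acuteSimplex : ∀ {n} (P : Matrix n) → Is01Matrix P →
  HasAcuteInverse (gram P) → IsAcute01Simplex (originAndColumns P)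
acuteInverse⇒acuteSimplex {n} P P-01 A = record
  { zeroOne = zeroOne ; independent = independent ; acute = acute }
  where
  open HasAcuteInverse A renaming (inverse to B)
  open IsInverse isInverse
  v : Points n
  v = originAndColumns P
  p q : Matrix n
  p = transpose P
  q j r = P r ∙ transpose B j
  Σq q₀ : Vector ℚ n
  Σq r = sum (λ i → q i r)
  q₀ r = - Σq r
  dual : Dual p q
  dual i j = trans (sym (∙-assoc (p i) P (transpose B j))) (inverseʳ i j)
  dual′ : ∀ i j → q i ∙ p j ≡ identity i j
  dual′ i j = trans (∙-comm (q i) (p j)) (trans (dual j i) (identity-sym j i))
  qq : ∀ i j → q i ∙ q j ≡ B j i
  qq i j = begin
    q i ∙ q j                          ≡⟨ ∙-comm (q i) (q j) ⟩
    q j ∙ q i                          ≡⟨ ∙-assoc (q j) P (transpose B i) ⟨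
    (λ k → q j ∙ p k) ∙ transpose B i  ≡⟨ ∙-congʳ (transpose B i) (dual′ j) ⟩
    identity j ∙ transpose B i         ≡⟨ ∙-identityˡ (transpose B i) j ⟩
    B j i                              ∎
  q₀q : ∀ j → q₀ ∙ q j ≡ - sum (B j)
  q₀q j = begin
    q₀ ∙ q j                      ≡⟨ ∙-comm q₀ (q j) ⟩
    q j ∙ q₀                      ≡⟨ ∙-negʳ (q j) Σq ⟩
    - (q j ∙ Σq)                  ≡⟨ cong -_ (sum-∙ (q j) q) ⟨
    - sum (λ i → q j ∙ q i)
      ≡⟨ cong -_ (sum-cong-≗ λ i → trans (∙-comm (q j) (q i)) (qq i j)) ⟩
    - sum (B j)                   ∎
  q₀p : ∀ j → q₀ ∙ p j ≡ - 1ℚ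
  q₀p j = begin
    q₀ ∙ p j                      ≡⟨ ∙-comm q₀ (p j) ⟩
    p j ∙ q₀                      ≡⟨ ∙-negʳ (p j) Σq ⟩
    - (p j ∙ Σq)                  ≡⟨ cong -_ (sum-∙ (p j) q) ⟨
    - sum (λ i → p j ∙ q i)       ≡⟨ cong -_ (sum-cong-≗ (dual j)) ⟩
    - sum (identity j)            ≡⟨ cong -_ (sum-cong-≗ λ i → *-identityʳ (identity j i)) ⟨
    - (identity j ∙ (λ _ → 1ℚ))   ≡⟨ cong -_ (∙-identityˡ (λ _ → 1ℚ) j) ⟩
    - 1ℚ                          ∎
  off : ∀ i j → j ≢ suc i → q i ∙ v j ≡ 0ℚ
  off i zero    _    = ∙-zeroʳ (q i)
  off i (suc j) j≢i = trans (dual′ i j) (identity-offDiagonal λ i≡j → j≢i (cong suc (sym i≡j)))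
  on : ∀ i → q i ∙ v (suc i) ≡ 1ℚ
  on i = trans (dual′ i i) (identity-diagonal i)
  normal : ∀ i → IsInwardNormal v (suc i) (q i)
  normal i = record
    { orthogonal = λ j k j≢i k≢i → trans (off i j j≢i) (sym (off i k k≢i))
    ; inward = λ j j≢i → subst₂ _<_ (sym (off i j j≢i)) (sym (on i)) 0<1 }
  normal₀ : IsInwardNormal v zero q₀
  normal₀ = record { orthogonal = orthogonal₀ ; inward = inward₀ }
    where
    orthogonal₀ : ∀ j k → j ≢ zero → k ≢ zero → q₀ ∙ v j ≡ q₀ ∙ v k
    orthogonal₀ zero    _       j≢0 _   = ⊥-elim (j≢0 refl)
    orthogonal₀ (suc j) zero    _   k≢0 = ⊥-elim (k≢0 refl)
    orthogonal₀ (suc j) (suc k) _   _   = trans (q₀p j) (sym (q₀p k))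
    inward₀ : ∀ j → j ≢ zero → q₀ ∙ v j < q₀ ∙ v zero
    inward₀ zero    j≢0 = ⊥-elim (j≢0 refl)
    inward₀ (suc j) _   = subst₂ _<_ (sym (q₀p j)) (sym (∙-zeroʳ q₀)) (pos⇒neg<0 0<1)
  q₀q<0 : ∀ j → q₀ ∙ q j < 0ℚ
  q₀q<0 j = subst (_< 0ℚ) (sym (q₀q j)) (pos⇒neg<0 (rowSum>0 j))
  zeroOne : ∀ i r → Is01 (v i r)
  zeroOne zero    r = inj₁ refl
  zeroOne (suc i) r = P-01 r i
  acute : ∀ i j → i ≢ j → AcuteDihedralAngle v i j
  acute zero    zero    i≢j = ⊥-elim (i≢j refl)
  acute zero    (suc j) _   = q₀ , q j , normal₀ , normal j , q₀q<0 j
  acute (suc i) zero    _   =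
    q i , q₀ , normal i , normal₀ , subst (_< 0ℚ) (∙-comm q₀ (q i)) (q₀q<0 i)
  acute (suc i) (suc j) i≢j = q i , q j , normal i , normal j ,
    subst (_< 0ℚ) (sym (qq i j)) (offDiagonal<0 j i (i≢j ∘ cong suc ∘ sym))
  independent : AffinelyIndependent v
  independent c Σc≡0 cv≡0 = λ { zero → c₀≡0 ; (suc i) → c′≡0 i }
    where
    c′ : Vector ℚ n
    c′ = c ∘ suc
    Pc′≡0 : ∀ r → P r ∙ c′ ≡ 0ℚ
    Pc′≡0 r = begin
      P r ∙ c′                ≡⟨ ∙-comm (P r) c′ ⟩
      c′ ∙ P r                ≡⟨ +-identityˡ (c′ ∙ P r) ⟨
      0ℚ + c′ ∙ P r           ≡⟨ cong (_+ c′ ∙ P r) (*-zeroʳ (c zero)) ⟨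
      c zero * 0ℚ + c′ ∙ P r  ≡⟨ cv≡0 r ⟩
      0ℚ                      ∎
    c′≡0 : ∀ i → c′ i ≡ 0ℚ
    c′≡0 i = begin
      c′ i                     ≡⟨ ∙-identityˡ c′ i ⟨
      identity i ∙ c′          ≡⟨ ∙-congʳ c′ (dual′ i) ⟨
      (λ j → q i ∙ p j) ∙ c′   ≡⟨ ∙-assoc (q i) P c′ ⟩
      q i ∙ (λ r → P r ∙ c′)   ≡⟨ ∙-congˡ (q i) Pc′≡0 ⟩
      q i ∙ (λ _ → 0ℚ)         ≡⟨ ∙-zeroʳ (q i) ⟩
      0ℚ                       ∎
    c₀≡0 : c zero ≡ 0ℚ
    c₀≡0 = begin
      c zero            ≡⟨ +-identityʳ (c zero) ⟨
      c zero + 0ℚ       ≡⟨ cong (λ ξ → c zero + ξ) (sum-zero c′ c′≡0) ⟨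
      c zero + sum c′   ≡⟨ Σc≡0 ⟩
      0ℚ                ∎

*-cancelˡ-neg : ∀ {a x} → 0ℚ < a → a * x < 0ℚ → x < 0ℚ
*-cancelˡ-neg {a} {x} 0<a ax<0 = *-cancelˡ-<-nonNeg a {{pos⇒nonNeg a {{positive 0<a}}}}
  (subst (a * x <_) (sym (*-zeroʳ a)) ax<0)

-- Each dihedral angle comes with its own pair of normals. Expanding these in one fixed dual basis
-- shows that they are multiples of common normals, and the signs of the multiples turn acuteness
-- into signs of the products of the common ones.
acuteSimplex⇒acuteDual : ∀ {n} (P : Matrix n) →
  IsAcute01Simplex (originAndColumns P) → AcuteDual (transpose P)
acuteSimplex⇒acuteDual {n} P A = record
  { normal = q ; dual = dual ; offDiagonal<0 = offDiagonal<0 ; rowSum>0 = rowSum>0 }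
  where
  open IsAcute01Simplex A
  open IsInwardNormal
  v : Points n
  v = originAndColumns P
  p : Matrix n
  p = transpose P
  off : ∀ {a u} → IsInwardNormal v (suc a) u → ∀ b → b ≢ a → u ∙ p b ≡ 0ℚ
  off {u = u} N b b≢a =
    trans (orthogonal N (suc b) zero (b≢a ∘ Fin.suc-injective) (λ ())) (∙-zeroʳ u)
  on : ∀ {a u} → IsInwardNormal v (suc a) u → 0ℚ < u ∙ p a
  on {a} {u} N = subst (_< u ∙ p a) (∙-zeroʳ u) (inward N zero λ ())
  -- One normal per facet is picked from its angle with the facet opposite the origin, an angle that
  -- every facet through the origin has.
  u : Matrix n
  u a = proj₁ (acute (suc a) zero λ ())
  N : ∀ a → IsInwardNormal v (suc a) (u a)
  N a = proj₁ (proj₂ (proj₂ (acute (suc a) zero λ ())))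
  scale : ∀ a → ∃[ t ] 0ℚ < t × t * (u a ∙ p a) ≡ 1ℚ
  scale a = reciprocal (on (N a))
  q : Matrix n
  q a r = proj₁ (scale a) * u a r
  dual : Dual p q
  dual i j = trans (∙-scaleʳ t (p i) (u j)) (trans (cong (t *_) (∙-comm (p i) (u j))) (entry i))
    where
    t = proj₁ (scale j)
    entry : ∀ i → t * (u j ∙ p i) ≡ identity i j
    entry i with i Fin.≟ j
    ... | yes refl = proj₂ (proj₂ (scale j))
    ... | no i≢j = trans (cong (t *_) (off (N j) i i≢j)) (*-zeroʳ t)
  normal-unique : ∀ {a w} → IsInwardNormal v (suc a) w → ∀ s → w s ≡ w ∙ p a * q a s
  normal-unique {a} {w} M s = begin
    w s ≡⟨ expansion dual w s ⟩
    (λ i → w ∙ p i) ∙ (λ i → q i s) ≡⟨ ∙-congʳ (λ i → q i s) coefficient ⟩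
    (λ i → w ∙ p a * identity a i) ∙ (λ i → q i s) ≡⟨ ∙-scaleˡ (w ∙ p a) (identity a) (λ i → q i s) ⟩
    w ∙ p a * (identity a ∙ (λ i → q i s)) ≡⟨ cong (w ∙ p a *_) (∙-identityˡ (λ i → q i s) a) ⟩
    w ∙ p a * q a s ∎
    where
    coefficient : ∀ i → w ∙ p i ≡ w ∙ p a * identity a i
    coefficient i with a Fin.≟ i
    ... | yes refl = sym (*-identityʳ (w ∙ p a))
    ... | no a≢i = trans (off M i (a≢i ∘ sym)) (sym (*-zeroʳ (w ∙ p a)))
  Σq : Vector ℚ n
  Σq s = sum (λ i → q i s)
  normal₀-unique : ∀ {w} a → IsInwardNormal v zero w → ∀ s → w s ≡ w ∙ p a * Σq s
  normal₀-unique {w} a M s = begin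
    w s ≡⟨ expansion dual w s ⟩
    (λ i → w ∙ p i) ∙ (λ i → q i s)
      ≡⟨ ∙-congʳ (λ i → q i s) (λ i → orthogonal M (suc i) (suc a) (λ ()) (λ ())) ⟩
    (λ _ → w ∙ p a) ∙ (λ i → q i s) ≡⟨ *-distribˡ-sum (w ∙ p a) (λ i → q i s) ⟨
    w ∙ p a * Σq s ∎
  offDiagonal<0 : ∀ i j → i ≢ j → q i ∙ q j < 0ℚ
  offDiagonal<0 i j i≢j =
    let w , w′ , M , M′ , ww′<0 = acute (suc i) (suc j) (i≢j ∘ Fin.suc-injective) in
    *-cancelˡ-neg (on M′) (*-cancelˡ-neg (on M) (subst (_< 0ℚ) (begin
      w ∙ w′                              ≡⟨ ∙-congʳ w′ (normal-unique M) ⟩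
      (λ s → w ∙ p i * q i s) ∙ w′        ≡⟨ ∙-scaleˡ (w ∙ p i) (q i) w′ ⟩
      w ∙ p i * (q i ∙ w′)                ≡⟨ cong (w ∙ p i *_) (∙-congˡ (q i) (normal-unique M′)) ⟩
      w ∙ p i * (q i ∙ (λ s → w′ ∙ p j * q j s)) ≡⟨ cong (w ∙ p i *_) (∙-scaleʳ (w′ ∙ p j) (q i) (q j)) ⟩
      w ∙ p i * (w′ ∙ p j * (q i ∙ q j))  ∎) ww′<0))
  rowSum>0 : ∀ i → 0ℚ < sum (λ j → q i ∙ q j)
  -- The normal `w′` points towards the origin, so `w′ ∙ p i` is negative. Its sign is moved onto
  -- `σ` so that only positive factors are cancelled.
  rowSum>0 i =
    let w , w′ , M , M′ , ww′<0 = acute (suc i) zero (λ ()) in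
    neg<0⇒pos (*-cancelˡ-neg
      (neg<0⇒pos (subst (_< 0ℚ) (sym (neg-involutive _)) (subst (w′ ∙ p i <_) (∙-zeroʳ w′) (inward M′ (suc i) λ ()))))
      (*-cancelˡ-neg (on M) (subst (_< 0ℚ) (begin
      w ∙ w′                              ≡⟨ ∙-congʳ w′ (normal-unique M) ⟩
      (λ s → w ∙ p i * q i s) ∙ w′        ≡⟨ ∙-scaleˡ (w ∙ p i) (q i) w′ ⟩
      w ∙ p i * (q i ∙ w′)                ≡⟨ cong (w ∙ p i *_) (∙-congˡ (q i) (normal₀-unique i M′)) ⟩
      w ∙ p i * (q i ∙ (λ s → w′ ∙ p i * Σq s)) ≡⟨ cong (w ∙ p i *_) (∙-scaleʳ (w′ ∙ p i) (q i) Σq) ⟩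
      w ∙ p i * (w′ ∙ p i * (q i ∙ Σq))   ≡⟨ cong (λ z → w ∙ p i * (w′ ∙ p i * z)) (sum-∙ (q i) q) ⟨
      w ∙ p i * (w′ ∙ p i * σ)
        ≡⟨ cong (w ∙ p i *_) (solve 2 (λ a b → a :* b := :- a :* :- b) refl (w′ ∙ p i) σ) ⟩
      w ∙ p i * (- (w′ ∙ p i) * - σ) ∎) ww′<0)))
    where
    σ = sum (λ j → q i ∙ q j)
    neg-involutive : ∀ x → - - x ≡ x
    neg-involutive x = solve 1 (λ x → :- (:- x) := x) refl x

-- The inverse is the Gramian of the normals: row `i` of `gram P` lists the coordinates of `p i` in
-- the basis of normals, so the product collapses to `p i ∙ q j`.
acuteDual⇒acuteInverse : ∀ {n} (P : Matrix n) → AcuteDual (transpose P) → HasAcuteInverse (gram P)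
acuteDual⇒acuteInverse {n} P A = record
  { inverse = B ; isInverse = record { inverseˡ = left ; inverseʳ = right }
  ; offDiagonal<0 = offDiagonal<0 ; rowSum>0 = rowSum>0 }
  where
  open AcuteDual A renaming (normal to q)
  p B : Matrix n
  p = transpose P
  B i j = q i ∙ q j
  right : ∀ i j → (gram P ⊗ B) i j ≡ identity i j
  right i j = begin
    gram P i ∙ (λ k → q k ∙ q j)             ≡⟨ ∙-assoc (gram P i) q (q j) ⟨
    (λ s → gram P i ∙ (λ k → q k s)) ∙ q j   ≡⟨ ∙-congʳ (q j) (expansion dual (p i)) ⟨
    p i ∙ q j                                ≡⟨ dual i j ⟩
    identity i j                             ∎
  left : ∀ i j → (B ⊗ gram P) i j ≡ identity i j
  left i j = begin
    B i ∙ (λ k → p k ∙ p j) ≡⟨ ∙-comm (B i) _ ⟩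
    (λ k → p k ∙ p j) ∙ B i ≡⟨ sum-cong-≗ (λ k → cong₂ _*_ (∙-comm (p k) (p j)) (∙-comm (q i) (q k))) ⟩
    gram P j ∙ (λ k → q k ∙ q i) ≡⟨ right j i ⟩
    identity j i ≡⟨ identity-sym j i ⟩
    identity i j ∎

-- The foot of the altitude from p j has positive barycentric coordinates in the
-- opposite facet; comparing coordinate r of both gives the sign of q j r.
module NormalSigns {n} (P : Matrix n) (P-01 : Is01Matrix P) (A : AcuteDual (transpose P)) where

  open AcuteDual A renaming (normal to q)

  normal-expansion : ∀ j r → q j r ≡ P r ∙ (λ i → q i ∙ q j)
  normal-expansion j r = begin
    q j r                              ≡⟨ ∙-identityˡ (q j) r ⟨
    identity r ∙ q j                   ≡⟨ ∙-congʳ (q j) (dual-transpose (transpose P) q dual r) ⟨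
    (λ s → P r ∙ (λ i → q i s)) ∙ q j  ≡⟨ ∙-assoc (P r) q (q j) ⟩
    P r ∙ (λ i → q i ∙ q j)            ∎

  -- The expansion keeps those terms of the row sum for which row `r` of `P` has a 1. The diagonal
  -- term is kept, so only negative terms are dropped from a positive sum.
  normal-pos : ∀ {r j} → P r j ≡ 1ℚ → 0ℚ < q j r
  normal-pos {r} {j} Prj≡1 = subst (0ℚ <_) (sym (normal-expansion j r))
    (<-≤-trans (subst (0ℚ <_) (sum-cong-≗ λ i → ∙-comm (q j) (q i)) (rowSum>0 j)) (sum-mono-≤ term))
    where
    term : ∀ i → q i ∙ q j ≤ P r i * (q i ∙ q j)
    term i with P-01 r i
    ... | inj₂ P≡1 = ≤-reflexive (sym (trans (cong (_* (q i ∙ q j)) P≡1) (*-identityˡ (q i ∙ q j))))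
    ... | inj₁ P≡0 = subst (q i ∙ q j ≤_)
      (sym (trans (cong (_* (q i ∙ q j)) P≡0) (*-zeroˡ (q i ∙ q j))))
      (<⇒≤ (offDiagonal<0 i j λ { refl → 1≢0 (trans (sym Prj≡1) P≡0) }))

  -- Now the diagonal term is dropped, so all terms are nonpositive. Some term is strictly negative
  -- because duality prevents row `r` of `P` from being zero.
  normal-neg : ∀ {r j} → P r j ≡ 0ℚ → q j r < 0ℚ
  normal-neg {r} {j} Prj≡0 =
    let i , Pq≢0 = sum-nonZero-term (λ i → P r i * q i r) Σ≢0
        P≡1 = one (P-01 r i) Pq≢0
    in subst (_< 0ℚ) (sym (normal-expansion j r)) (sum-neg-< term i (strict i P≡1))
    where
    Σ≢0 : P r ∙ (λ i → q i r) ≢ 0ℚ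
    Σ≢0 Σ≡0 = 1≢0 (trans (sym (trans (dual-transpose (transpose P) q dual r r) (identity-diagonal r))) Σ≡0)
    one : ∀ {x y} → Is01 x → x * y ≢ 0ℚ → x ≡ 1ℚ
    one {y = y} (inj₁ refl) 0y≢0 = ⊥-elim (0y≢0 (*-zeroˡ y))
    one (inj₂ x≡1) _ = x≡1
    strict : ∀ i → P r i ≡ 1ℚ → P r i * (q i ∙ q j) < 0ℚ
    strict i P≡1 = subst (_< 0ℚ)
      (sym (trans (cong (_* (q i ∙ q j)) P≡1) (*-identityˡ (q i ∙ q j))))
      (offDiagonal<0 i j λ { refl → 1≢0 (trans (sym P≡1) Prj≡0) })
    term : ∀ i → P r i * (q i ∙ q j) ≤ 0ℚ
    term i with P-01 r i
    ... | inj₁ P≡0 = ≤-reflexive (trans (cong (_* (q i ∙ q j)) P≡0) (*-zeroˡ (q i ∙ q j)))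
    ... | inj₂ P≡1 = <⇒≤ (strict i P≡1)

-- The matrices H_λ

hess-below : ∀ e c i j → j ℕ.< i → hess e c (suc i) j ≡ 0ℚ
hess-below e c (suc i) zero    _         = refl
hess-below e c (suc i) (suc j) (s≤s j<i) = hess-below (not (c 0)) (c ∘ suc) i j j<i

hess-subdiagonal : ∀ e c i → hess e c (suc i) i ≡ 1ℚ
hess-subdiagonal e c zero    = refl
hess-subdiagonal e c (suc i) = hess-subdiagonal (not (c 0)) (c ∘ suc) i

hess-above : ∀ e c i j → i ℕ.< j → hess e c (suc i) j ≡ agree (not (c i)) (c j)
hess-above e c zero    (suc j) _         = refl
hess-above e c (suc i) (suc j) (s≤s i<j) = hess-above (not (c 0)) (c ∘ suc) i j i<j

-- Indices beyond the given blocks get the colour that alternates with the last block, in accordance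
-- with the extra block of `locate`; this colours the final column block too.
blockColour : ∀ {k} → Bool → Vec ℕ k → ℕ → Bool
blockColour e Vec.[]       j = e
blockColour e (a Vec.∷ as) j = if j ℕ.<ᵇ a then e else blockColour (not e) as (j ∸ a)

flips : Bool → ℕ → Bool
flips e zero    = e
flips e (suc b) = flips (not e) b

blockColour-locate : ∀ {k} e (as : Vec ℕ k) j → blockColour e as j ≡ flips e (proj₁ (locate as j))
blockColour-locate e Vec.[]       j = refl
blockColour-locate e (a Vec.∷ as) j with j ℕ.<ᵇ a
... | true  = refl
... | false = blockColour-locate (not e) as (j ∸ a)

locate-mono : ∀ {k} (as : Vec ℕ k) {i j} → i ℕ.< j →
  proj₁ (locate as i) ℕ.< proj₁ (locate as j) ⊎
  (proj₁ (locate as i) ≡ proj₁ (locate as j) × proj₂ (locate as i) ℕ.< proj₂ (locate as j))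
locate-mono Vec.[] i<j = inj₂ (refl , i<j)
locate-mono (a Vec.∷ as) {i} {j} i<j with i ℕ.<ᵇ a in i<ᵇa | j ℕ.<ᵇ a in j<ᵇa
... | true  | true  = inj₂ (refl , i<j)
... | true  | false = inj₁ (s≤s z≤n)
... | false | true  = ⊥-elim (subst T i<ᵇa
  (ℕ.<⇒<ᵇ (ℕ.<-trans i<j (ℕ.<ᵇ⇒< j a (subst T (sym j<ᵇa) _)))))
... | false | false =
  Sum.map s≤s (λ (b≡b , p<p) → cong suc b≡b , p<p)
    (locate-mono as (ℕ.∸-monoˡ-< {i} {a} {j} i<j (ℕ.≮⇒≥ λ i<a → subst T i<ᵇa (ℕ.<⇒<ᵇ i<a))))

parityEntry : Parity → ℚ
parityEntry 0ℙ = 0ℚ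
parityEntry 1ℙ = 1ℚ

parityEntry-flips : ∀ e d → parityEntry (parity d) ≡ agree (not e) (flips e d)
parityEntry-flips true  zero = refl
parityEntry-flips false zero = refl
parityEntry-flips true  (suc zero) = refl
parityEntry-flips false (suc zero) = refl
parityEntry-flips e (suc (suc d)) =
  trans (parityEntry-flips e d) (cong (λ x → agree (not e) (flips x d)) (sym (Bool.not-involutive e)))

parityEntry-∸ : ∀ e {b b′} → b ℕ.< b′ →
  parityEntry (parity (b′ ∸ b)) ≡ agree (not (flips e b)) (flips e b′)
parityEntry-∸ e {zero}  {b′}     _         = parityEntry-flips e b′
parityEntry-∸ e {suc b} {suc b′} (s≤s b<b′) = parityEntry-∸ (not e) b<b′

blockEntry-< : ∀ I J p q → I ℕ.< J → blockEntry (I , p) (J , q) ≡ parityEntry (parity (J ∸ I))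
blockEntry-< I J p q I<J with ℕ.<-cmp I J
... | tri≈ I≮J _ _ = ⊥-elim (I≮J I<J)
... | tri> I≮J _ _ = ⊥-elim (I≮J I<J)
... | tri< _ _ _ with parity (J ∸ I)
... | 0ℙ = refl
... | 1ℙ = refl

blockEntry-≡ : ∀ I J p q → I ≡ J → blockEntry (I , p) (J , q) ≡ (if p ℕ.≡ᵇ q then 1ℚ else 0ℚ)
blockEntry-≡ I J p q I≡J with ℕ.<-cmp I J
... | tri< _ I≢J _ = ⊥-elim (I≢J I≡J)
... | tri≈ _ _ _ = refl
... | tri> _ I≢J _ = ⊥-elim (I≢J I≡J)

blockEntry-> : ∀ I J p q → J ℕ.< I → blockEntry (I , p) (J , q) ≡ 0ℚ
blockEntry-> I J p q J<I with ℕ.<-cmp I J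
... | tri< _ _ J≮I = ⊥-elim (J≮I J<I)
... | tri≈ _ _ J≮I = ⊥-elim (J≮I J<I)
... | tri> _ _ _ = refl

-- Row `i + 1` and column `i` have the same block number and position, so the subdiagonal runs along
-- the diagonals of the identity blocks. Elsewhere in such a block the entry is 0: below the
-- subdiagonal by the Hessenberg shape, above it because row and column have opposite colours.
blockEntry≡hess : ∀ {k} (as : Vec ℕ k) i j →
  blockEntry (rowBlock as i) (colBlock as j) ≡ hess true (blockColour true as) i j
blockEntry≡hess as zero j = begin
  blockEntry (0 , 0) (suc b , proj₂ (locate as j)) ≡⟨ blockEntry-< 0 (suc b) 0 (proj₂ (locate as j)) (s≤s z≤n) ⟩
  -- Row 0 is treated as if it followed a column block number 0 of colour `false`, so that its own
  -- colour is `true`.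
  parityEntry (parity (suc b))     ≡⟨ parityEntry-flips false (suc b) ⟩
  agree true (flips true b)        ≡⟨ cong (agree true) (blockColour-locate true as j) ⟨
  agree true (blockColour true as j) ∎
  where b = proj₁ (locate as j)
blockEntry≡hess as (suc i) j with ℕ.<-cmp i j
... | tri≈ _ refl _ = begin
  blockEntry (suc b , p) (suc b , p) ≡⟨ blockEntry-≡ (suc b) (suc b) p p refl ⟩
  (if p ℕ.≡ᵇ p then 1ℚ else 0ℚ) ≡⟨ cong (if_then 1ℚ else 0ℚ) (dec-true (p ℕ.≟ p) refl) ⟩
  1ℚ ≡⟨ hess-subdiagonal true (blockColour true as) i ⟨
  hess true (blockColour true as) (suc i) i ∎
  where
  b = proj₁ (locate as i)
  p = proj₂ (locate as i)
... | tri> _ _ j<i = trans (entry (locate-mono as j<i))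
  (sym (hess-below true (blockColour true as) i j j<i))
  where
  b = proj₁ (locate as i)
  p = proj₂ (locate as i)
  b′ = proj₁ (locate as j)
  p′ = proj₂ (locate as j)
  entry : b′ ℕ.< b ⊎ (b′ ≡ b × p′ ℕ.< p) → blockEntry (suc b , p) (suc b′ , p′) ≡ 0ℚ
  entry (inj₁ b′<b) = blockEntry-> (suc b) (suc b′) p p′ (s≤s b′<b)
  entry (inj₂ (b′≡b , p′<p)) = trans (blockEntry-≡ (suc b) (suc b′) p p′ (cong suc (sym b′≡b)))
    (cong (if_then 1ℚ else 0ℚ) (dec-false (p ℕ.≟ p′) (ℕ.>⇒≢ p′<p)))
... | tri< i<j _ _ = trans (entry (locate-mono as i<j))
  (trans (cong₂ (λ x y → agree (not x) y) (sym (blockColour-locate true as i)) (sym (blockColour-locate true as j)))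
    (sym (hess-above true (blockColour true as) i j i<j)))
  where
  b = proj₁ (locate as i)
  p = proj₂ (locate as i)
  b′ = proj₁ (locate as j)
  p′ = proj₂ (locate as j)
  entry : b ℕ.< b′ ⊎ (b ≡ b′ × p ℕ.< p′) →
          blockEntry (suc b , p) (suc b′ , p′) ≡ agree (not (flips true b)) (flips true b′)
  entry (inj₁ b<b′) = trans (blockEntry-< (suc b) (suc b′) p p′ (s≤s b<b′)) (parityEntry-∸ true b<b′)
  entry (inj₂ (b≡b′ , p<p′)) = begin
    blockEntry (suc b , p) (suc b′ , p′) ≡⟨ blockEntry-≡ (suc b) (suc b′) p p′ (cong suc b≡b′) ⟩
    (if p ℕ.≡ᵇ p′ then 1ℚ else 0ℚ) ≡⟨ cong (if_then 1ℚ else 0ℚ) (dec-false (p ℕ.≟ p′) (ℕ.<⇒≢ p<p′)) ⟩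
    0ℚ ≡⟨ agree-notˡ-self (flips true b) ⟨
    agree (not (flips true b)) (flips true b) ≡⟨ cong (λ x → agree (not (flips true b)) (flips true x)) b≡b′ ⟩
    agree (not (flips true b)) (flips true b′) ∎

blockColour-+ : ∀ {k} e a (as : Vec ℕ k) j →
  blockColour e (a Vec.∷ as) (a ℕ.+ j) ≡ blockColour (not e) as j
blockColour-+ e zero    as j = refl
blockColour-+ e (suc a) as j = blockColour-+ e a as j

blockColour-first : ∀ {k} e a (as : Vec ℕ k) {j} → j ℕ.< a → blockColour e (a Vec.∷ as) j ≡ e
blockColour-first e (suc a) as {zero}  _         = refl
blockColour-first e (suc a) as {suc j} (s≤s j<a) = blockColour-first e a as j<a

-- Index `suc m` is the first one beyond the given blocks, and `m` lies in the last of them because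
-- that part is positive.
blockColour-end : ∀ {k} e (as : Vec ℕ (suc k)) → All NonZero as → ∀ {m} → Vec.sum as ≡ suc m →
  blockColour e as (suc m) ≡ not (blockColour e as m)
blockColour-end e (a Vec.∷ Vec.[]) _ {m} a+0≡ =
  subst (λ a → blockColour e (a Vec.∷ Vec.[]) (suc m) ≡ not (blockColour e (a Vec.∷ Vec.[]) m))
    (trans (sym a+0≡) (ℕ.+-identityʳ a))
    (trans (trans (cong (blockColour e (suc m Vec.∷ Vec.[])) (sym (ℕ.+-identityʳ (suc m))))
                  (blockColour-+ e (suc m) Vec.[] 0))
           (cong not (sym (blockColour-first e (suc m) Vec.[] (ℕ.n<1+n m)))))
blockColour-end e (a Vec.∷ zero Vec.∷ as) (_ All.∷ record { nonZero = () } All.∷ _)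
blockColour-end e (a Vec.∷ suc b Vec.∷ as) (_ All.∷ nz) {m} a+s≡ =
  subst (λ j → blockColour e xs j ≡ not (blockColour e xs m)) a+s≡
    (subst (λ j → blockColour e xs (a ℕ.+ suc s) ≡ not (blockColour e xs j)) a+s′≡
      (trans (blockColour-+ e a (suc b Vec.∷ as) (suc s))
        (trans (blockColour-end (not e) (suc b Vec.∷ as) nz refl)
               (cong not (sym (blockColour-+ e a (suc b Vec.∷ as) s))))))
  where
  xs = a Vec.∷ suc b Vec.∷ as
  s = b ℕ.+ Vec.sum as
  a+s′≡ : a ℕ.+ s ≡ m
  a+s′≡ = ℕ.suc-injective (trans (sym (ℕ.+-suc a s)) a+s≡)

-- Determinants

det-cong : ∀ {n} {A B : Matrix n} → (∀ i j → A i j ≡ B i j) → det A ≡ det B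
det-cong {zero}  A≗B = refl
det-cong {suc n} A≗B = sum-cong-≗ λ i →
  cong₂ (λ x d → (- 1ℚ) ^ toℕ i * x * d) (A≗B i zero) (det-cong λ r s → A≗B (punchIn i r) (suc s))

hess-lowerRows : ∀ e e′ c i j → hess e c (suc i) j ≡ hess e′ c (suc i) j
hess-lowerRows e e′ c zero    zero    = refl
hess-lowerRows e e′ c (suc i) zero    = refl
hess-lowerRows e e′ c i       (suc j) = refl

-- Only the first two entries of column 0 can be nonzero. Deleting row 0 leaves a matrix whose first
-- row has colour `not (c 0)`; deleting row 1 leaves one whose first row still has colour `e`.
det-hessenberg : ∀ e c n →
  det (hessenberg {suc (suc n)} e c) ≡
  agree e (c 0) * det (hessenberg {suc n} (not (c 0)) (c ∘ suc)) + - det (hessenberg {suc n} e (c ∘ suc))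
det-hessenberg e c n = begin
  1ℚ * x * d₀ + ((- 1ℚ) ^ 1 * 1ℚ * det minor₁ + sum lower)
    ≡⟨ cong₂ (λ d s → 1ℚ * x * d₀ + ((- 1ℚ) ^ 1 * 1ℚ * d + s))
         (det-cong {A = minor₁} {hessenberg e (c ∘ suc)} minor₁≗)
         (sum-zero lower λ i → trans (cong (_* det (minor i)) (*-zeroʳ ((- 1ℚ) ^ toℕ (suc (suc i))))) (*-zeroˡ (det (minor i)))) ⟩
  1ℚ * x * d₀ + (- 1ℚ * d₁ + 0ℚ)
    ≡⟨ solve 3 (λ x a b → con 1ℚ :* x :* a :+ (:- con 1ℚ :* b :+ con 0ℚ) := x :* a :+ :- b) refl x d₀ d₁ ⟩
  x * d₀ + - d₁ ∎
  where
  x = agree e (c 0)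
  d₀ = det (hessenberg {suc n} (not (c 0)) (c ∘ suc))
  d₁ = det (hessenberg {suc n} e (c ∘ suc))
  minor₁ : Matrix (suc n)
  minor₁ r s = hess e c (toℕ (punchIn (suc zero) r)) (suc (toℕ s))
  minor₁≗ : ∀ r s → minor₁ r s ≡ hess e (c ∘ suc) (toℕ r) (toℕ s)
  minor₁≗ zero    s = refl
  minor₁≗ (suc r) s = hess-lowerRows (not (c 0)) e (c ∘ suc) (toℕ r) (toℕ s)
  minor : Fin n → Matrix (suc n)
  minor i r s = hess e c (toℕ (punchIn (suc (suc i)) r)) (suc (toℕ s))
  lower : Vector ℚ n
  lower i = (- 1ℚ) ^ toℕ (suc (suc i)) * 0ℚ * det (minor i)

ι : ℕ → ℚ
ι n = + n / 1

toℚᵘ-ι : ∀ n → toℚᵘ (ι n) ℚᵘ.≃ ℚᵘ.mkℚᵘ (+ n) 0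
toℚᵘ-ι n = toℚᵘ-fromℚᵘ (ℚᵘ.mkℚᵘ (+ n) 0)

ι-+ : ∀ m n → ι (m ℕ.+ n) ≡ ι m + ι n
ι-+ m n = toℚᵘ-injective (ℚᵘ.≃-trans (toℚᵘ-ι (m ℕ.+ n)) (ℚᵘ.≃-trans
  (ℚᵘ.*≡* (cong (ℤ._* + 1) (cong₂ ℤ._+_ (sym (ℤ.*-identityʳ (+ m))) (sym (ℤ.*-identityʳ (+ n))))))
  (ℚᵘ.≃-sym (ℚᵘ.≃-trans (toℚᵘ-homo-+ (ι m) (ι n)) (ℚᵘ.+-cong (toℚᵘ-ι m) (toℚᵘ-ι n))))))

ι-* : ∀ m n → ι (m ℕ.* n) ≡ ι m * ι n
ι-* zero n = sym (*-zeroˡ (ι n))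
ι-* (suc m) n = begin
  ι (n ℕ.+ m ℕ.* n)      ≡⟨ ι-+ n (m ℕ.* n) ⟩
  ι n + ι (m ℕ.* n)      ≡⟨ cong (λ ξ → ι n + ξ) (ι-* m n) ⟩
  ι n + ι m * ι n        ≡⟨ solve 2 (λ m n → n :+ m :* n := (con 1ℚ :+ m) :* n) refl (ι m) (ι n) ⟩
  (1ℚ + ι m) * ι n       ≡⟨ cong (_* ι n) (ι-+ 1 m) ⟨
  ι (suc m) * ι n          ∎

ι-nonNeg : ∀ n → 0ℚ ≤ ι n
ι-nonNeg n = nonNegative⁻¹ (ι n) {{normalize-nonNeg n 1}}

ι-injective : ∀ {m n} → ι m ≡ ι n → m ≡ n
ι-injective {m} {n} ιm≡ιn with /-injective-≃ (ℚᵘ.mkℚᵘ (+ m) 0) (ℚᵘ.mkℚᵘ (+ n) 0) ιm≡ιn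
... | ℚᵘ.*≡* m*1≡n*1 = ℤ.+-injective (ℤ.*-cancelʳ-≡ (+ m) (+ n) (+ 1) m*1≡n*1)

/-*-ι : ∀ f g .{{_ : NonZero g}} → + f / g * ι g ≡ ι f
/-*-ι f (suc g) = toℚᵘ-injective (ℚᵘ.≃-trans (toℚᵘ-homo-* (+ f / suc g) (ι (suc g))) (ℚᵘ.≃-trans
  (ℚᵘ.*-cong (toℚᵘ-fromℚᵘ (ℚᵘ.mkℚᵘ (+ f) g)) (toℚᵘ-ι (suc g))) (ℚᵘ.≃-trans
  (ℚᵘ.*≡* (trans (ℤ.*-assoc (+ f) (+ suc g) (+ 1)) (cong (+ f ℤ.*_) (ℤ.pos-* (suc g) 1))))
  (ℚᵘ.≃-sym (toℚᵘ-ι f)))))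

-- Numerator and denominator of the continued fraction. The empty one counts as 1/0, which lets one
-- recursion cover the last part as well.
continuants : ∀ {k} → Vec ℕ k → ℕ × ℕ
continuants Vec.[]       = 1 , 0
continuants (a Vec.∷ as) = let f , g = continuants as in a ℕ.* f ℕ.+ g , f

continuants-coprime : ∀ {k} (as : Vec ℕ k) → Coprime (proj₁ (continuants as)) (proj₂ (continuants as))
continuants-coprime Vec.[] (d∣1 , _) = ∣1⇒≡1 d∣1
continuants-coprime (a Vec.∷ as) (d∣af+g , d∣f) =
  continuants-coprime as (d∣f , ∣m+n∣m⇒∣n d∣af+g (∣n⇒∣m*n a d∣f))

contFrac-continuants : ∀ {k} (as : Vec ℕ (suc k)) (nz : All NonZero as) →
  contFrac as nz * ι (proj₂ (continuants as)) ≡ ι (proj₁ (continuants as))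
contFrac-continuants (a Vec.∷ Vec.[]) nz = trans (sym (ι-* a 1)) (cong ι (sym (ℕ.+-identityʳ (a ℕ.* 1))))
contFrac-continuants (a Vec.∷ b Vec.∷ as) (_ All.∷ nz) = begin
  (ι a + 1/x) * ι f        ≡⟨ *-distribʳ-+ (ι f) (ι a) 1/x ⟩
  ι a * ι f + 1/x * ι f    ≡⟨ cong₂ _+_ (sym (ι-* a f)) inner ⟩
  ι (a ℕ.* f) + ι g        ≡⟨ ι-+ (a ℕ.* f) g ⟨
  ι (a ℕ.* f ℕ.+ g)        ∎
  where
  f = proj₁ (continuants (b Vec.∷ as))
  g = proj₂ (continuants (b Vec.∷ as))
  x = contFrac (b Vec.∷ as) nz
  x≢0 : ℚ.NonZero x
  x≢0 = pos⇒nonZero x {{contFrac-pos (b Vec.∷ as) nz}}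
  1/x = (1/ x) {{x≢0}}
  inner : 1/x * ι f ≡ ι g
  inner = begin
    1/x * ι f         ≡⟨ cong (1/x *_) (contFrac-continuants (b Vec.∷ as) nz) ⟨
    1/x * (x * ι g)   ≡⟨ *-assoc 1/x x (ι g) ⟨
    1/x * x * ι g     ≡⟨ cong (_* ι g) (*-inverseˡ x {{x≢0}}) ⟩
    1ℚ * ι g          ≡⟨ *-identityˡ (ι g) ⟩
    ι g               ∎

-- Cross-multiplication and coprimality make the numerators divide each other. This identifies an
-- arbitrary reduced numerator with the continuant.
reduced-numerator-unique : ∀ x f g f′ g′ → x * ι g ≡ ι f → x * ι g′ ≡ ι f′ →
  Coprime f g → Coprime f′ g′ → f ≡ f′
reduced-numerator-unique x f g f′ g′ xg≡f xg′≡f′ cop cop′ =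
  ∣-antisym (coprime-divisor cop (divides g′ (trans cross (ℕ.*-comm f g′))))
            (coprime-divisor cop′ (divides g (trans (ℕ.*-comm g′ f) (sym cross))))
  where
  cross : g ℕ.* f′ ≡ f ℕ.* g′
  cross = ι-injective (begin
    ι (g ℕ.* f′)      ≡⟨ ι-* g f′ ⟩
    ι g * ι f′        ≡⟨ cong (ι g *_) xg′≡f′ ⟨
    ι g * (x * ι g′)  ≡⟨ solve 3 (λ g x g′ → g :* (x :* g′) := x :* g :* g′) refl (ι g) x (ι g′) ⟩
    x * ι g * ι g′    ≡⟨ cong (_* ι g′) xg≡f ⟩
    ι f * ι g′        ≡⟨ ι-* f g′ ⟨
    ι (f ℕ.* g′)      ∎)

∣unit*ι∣ : ∀ {s} n → s ≡ 1ℚ ⊎ s ≡ - 1ℚ → ∣ s * ι n ∣ ≡ ι n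
∣unit*ι∣ {s} n s≡±1 = begin
  ∣ s * ι n ∣       ≡⟨ ∣p*q∣≡∣p∣*∣q∣ s (ι n) ⟩
  ∣ s ∣ * ∣ ι n ∣   ≡⟨ cong₂ _*_ (∣s∣≡1 s≡±1) (0≤p⇒∣p∣≡p (ι-nonNeg n)) ⟩
  1ℚ * ι n          ≡⟨ *-identityˡ (ι n) ⟩
  ι n               ∎
  where
  ∣s∣≡1 : ∀ {s} → s ≡ 1ℚ ⊎ s ≡ - 1ℚ → ∣ s ∣ ≡ 1ℚ
  ∣s∣≡1 (inj₁ refl) = refl
  ∣s∣≡1 (inj₂ refl) = refl

-- Expanding along the first column of a run of equal colours performs the steps
-- of the Euclidean algorithm on the determinants for the two colours of row 0.
det-blockColour : ∀ {k} e (as : Vec ℕ k) → let f , g = continuants as in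
  ∃[ s ] (s ≡ 1ℚ ⊎ s ≡ - 1ℚ)
    × det (hessenberg {suc (Vec.sum as)} e (blockColour e as)) ≡ s * ι f
    × det (hessenberg {suc (Vec.sum as)} (not e) (blockColour e as)) ≡ - s * ι g
det-blockColour true  Vec.[] = 1ℚ , inj₁ refl , refl , refl
det-blockColour false Vec.[] = 1ℚ , inj₁ refl , refl , refl
det-blockColour {suc k} e (a Vec.∷ as) = run a
  where
  f g : ℕ
  f = proj₁ (continuants as)
  g = proj₂ (continuants as)
  -neg : ∀ {s} → s ≡ 1ℚ ⊎ s ≡ - 1ℚ → - s ≡ 1ℚ ⊎ - s ≡ - 1ℚ
  -neg (inj₁ refl) = inj₂ refl
  -neg (inj₂ refl) = inj₁ refl
  run : ∀ a → ∃[ s ] (s ≡ 1ℚ ⊎ s ≡ - 1ℚ)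
    × det (hessenberg {suc (a ℕ.+ Vec.sum as)} e (blockColour e (a Vec.∷ as))) ≡ s * ι (a ℕ.* f ℕ.+ g)
    × det (hessenberg {suc (a ℕ.+ Vec.sum as)} (not e) (blockColour e (a Vec.∷ as))) ≡ - s * ι f
  -- With the run used up, the remaining blocks start with colour `not e`, so the two determinants
  -- exchange roles, like numerator and denominator of a reciprocal.
  run zero =
    let s , s≡±1 , D≡ , D′≡ = det-blockColour (not e) as in
    - s , -neg s≡±1
    , trans (cong (λ x → det (hessenberg {suc (Vec.sum as)} x (blockColour (not e) as))) (sym (Bool.not-involutive e))) D′≡
    , trans D≡ (solve 2 (λ s f → s :* f := :- (:- s) :* f) refl s (ι f))
  -- One more column replaces `D` by `D′ - D`, which up to sign adds `f` to the numerator, while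
  -- `D′` merely changes sign.
  run (suc a) =
    let s , s≡±1 , D≡ , D′≡ = run a in
    - s , -neg s≡±1
    , (begin
      det (hessenberg {suc (suc (a ℕ.+ Vec.sum as))} e (blockColour e (suc a Vec.∷ as)))
        ≡⟨ det-hessenberg e (blockColour e (suc a Vec.∷ as)) (a ℕ.+ Vec.sum as) ⟩
      agree e e * D′ + - D
        ≡⟨ cong₂ _+_ (cong₂ _*_ (agree-refl e) D′≡) (cong -_ D≡) ⟩
      1ℚ * (- s * ι f) + - (s * ι h)
        ≡⟨ solve 3 (λ s f h → con 1ℚ :* (:- s :* f) :+ :- (s :* h) := :- s :* (f :+ h)) refl s (ι f) (ι h) ⟩
      - s * (ι f + ι h) ≡⟨ cong (- s *_) (ι-+ f h) ⟨
      - s * ι (f ℕ.+ h) ≡⟨ cong (λ x → - s * ι x) (ℕ.+-assoc f (a ℕ.* f) g) ⟨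
      - s * ι (suc a ℕ.* f ℕ.+ g) ∎)
    , (begin
      det (hessenberg {suc (suc (a ℕ.+ Vec.sum as))} (not e) (blockColour e (suc a Vec.∷ as)))
        ≡⟨ det-hessenberg (not e) (blockColour e (suc a Vec.∷ as)) (a ℕ.+ Vec.sum as) ⟩
      agree (not e) e * D′ + - D′
        ≡⟨ cong₂ (λ x y → x * y + - y) (agree-notˡ-self e) D′≡ ⟩
      0ℚ * (- s * ι f) + - (- s * ι f)
        ≡⟨ solve 2 (λ s f → con 0ℚ :* (:- s :* f) :+ :- (:- s :* f) := :- (:- s) :* f) refl s (ι f) ⟩
      - - s * ι f ∎)
    where
    h : ℕ
    h = a ℕ.* f ℕ.+ g
    D D′ : ℚ
    D = det (hessenberg {suc (a ℕ.+ Vec.sum as)} e (blockColour e (a Vec.∷ as)))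
    D′ = det (hessenberg {suc (a ℕ.+ Vec.sum as)} (not e) (blockColour e (a Vec.∷ as)))

det-Hλ : ∀ n {k} (comp : Composition n (suc k)) (f g : ℕ) .{{_ : NonZero g}} →
  + f / g ≡ contFracOf comp → gcd f g ≡ 1 → ∣ det (Hλ (suc n) comp) ∣ ≡ + f / 1
det-Hλ n comp@record { parts = as ; positive = nz ; total = refl } f g f/g≡ gcd≡1 =
  let s , s≡±1 , D≡ , _ = det-blockColour true as in begin
  ∣ det (Hλ (suc n) comp) ∣
    ≡⟨ cong ∣_∣ (det-cong {suc n} {Hλ (suc n) comp} {hessenberg true (blockColour true as)}
         λ i j → blockEntry≡hess as (toℕ i) (toℕ j)) ⟩
  ∣ det (hessenberg {suc n} true (blockColour true as)) ∣ ≡⟨ cong ∣_∣ D≡ ⟩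
  ∣ s * ι f′ ∣ ≡⟨ ∣unit*ι∣ f′ s≡±1 ⟩
  ι f′ ≡⟨ cong ι (reduced-numerator-unique (contFrac as nz) f′ (proj₂ (continuants as)) f g
      (contFrac-continuants as nz) (trans (cong (_* ι g) (sym f/g≡)) (/-*-ι f g))
      (continuants-coprime as) (gcd≡1⇒coprime gcd≡1)) ⟩
  ι f ∎
  where
  f′ = proj₁ (continuants as)

-- Acute Hessenberg matrices

SameSign WeakOppositeSign OppositeSign : ℚ → ℚ → Set
SameSign         x y = (x ≡ 1ℚ → 0ℚ < y) × (x ≡ 0ℚ → y < 0ℚ)
WeakOppositeSign x y = (x ≡ 1ℚ → y ≤ 0ℚ) × (x ≡ 0ℚ → 0ℚ ≤ y)
OppositeSign     x y = (x ≡ 1ℚ → y < 0ℚ) × (x ≡ 0ℚ → 0ℚ < y)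

-- X is a lower right part of H and Y is the same part of the matrix of normals.
-- On the columns of X, every row of H down to row 0 of X equals row 0 of X or its
-- complement; a and b are the sums of the rows of normals of the two kinds.
record Elimination {m} (X Y : Matrix (suc m)) (a b : Vector ℚ (suc m)) : Set where
  field
    zeroOne      : Is01Matrix X
    isHessenberg : IsUnreducedUpperHessenberg X
    signs        : ∀ i j → SameSign (X i j) (Y i j)
    a-signs      : ∀ j → SameSign (X zero j) (a j)
    b-signs      : ∀ j → WeakOppositeSign (X zero j) (b j)
    relation     : ∀ k l →
      X zero k * a l + (1ℚ - X zero k) * b l + sum {m} (λ i → X (suc i) k * Y (suc i) l) ≡ identity k l

open Elimination
open IsUnreducedUpperHessenberg

lowerRight : ∀ {m} → Matrix (suc m) → Matrix m
lowerRight X i j = X (suc i) (suc j)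

subdiagonal≡1 : ∀ {m} {X : Matrix m} → Is01Matrix X → IsUnreducedUpperHessenberg X →
  ∀ i j → toℕ i ≡ suc (toℕ j) → X i j ≡ 1ℚ
subdiagonal≡1 X-01 X-H i j i≡j+1 with X-01 i j
... | inj₁ X≡0 = ⊥-elim (unreduced X-H i j i≡j+1 X≡0)
... | inj₂ X≡1 = X≡1

sum-zero⇒neg : ∀ {x y} → x + y ≡ 0ℚ → x ≡ - y
sum-zero⇒neg {x} {y} x+y≡0 = begin
  x              ≡⟨ solve 2 (λ x y → x := (x :+ y) :+ :- y) refl x y ⟩
  x + y + - y    ≡⟨ cong (_+ - y) x+y≡0 ⟩
  0ℚ + - y       ≡⟨ +-identityˡ (- y) ⟩
  - y            ∎

module Step {m} {X Y : Matrix (suc (suc m))} {a b : Vector ℚ (suc (suc m))}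
            (E : Elimination X Y a b) where

  private
    x : ℚ
    x = X zero zero
    X₀ X₁ Y₁ a′ b′ : Vector ℚ (suc m)
    X₀ j = X zero (suc j)
    X₁ j = X (suc zero) (suc j)
    Y₁ j = Y (suc zero) (suc j)
    a′ j = a (suc j)
    b′ j = b (suc j)
    rest : ∀ k l → ℚ
    rest k l = sum {m} (λ i → X (suc (suc i)) k * Y (suc (suc i)) l)

  -- Column 0 of `X` is `x`, 1, 0, 0, ..., so its relation with a later normal stops at row 1. As
  -- `x` is 0 or 1, it equates `- Y₁` with one of `a′` and `b′`.
  firstColumn : ∀ l → x * a′ l + (1ℚ - x) * b′ l + Y₁ l ≡ 0ℚ
  firstColumn l = begin
    s + Y₁ l
      ≡⟨ cong (λ ξ → s + ξ) (solve 1 (λ y → y := con 1ℚ :* y :+ con 0ℚ) refl (Y₁ l)) ⟩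
    s + (1ℚ * Y₁ l + 0ℚ)
      ≡⟨ cong₂ (λ ξ η → s + (ξ * Y₁ l + η)) (subdiagonal≡1 (zeroOne E) (isHessenberg E) (suc zero) zero refl)
           (sum-zero _ λ i → trans (cong (_* Y (suc (suc i)) (suc l))
             (upperHessenberg (isHessenberg E) (suc (suc i)) zero (s≤s (s≤s z≤n))))
             (*-zeroˡ (Y (suc (suc i)) (suc l)))) ⟨
    s + (X (suc zero) zero * Y₁ l + rest zero (suc l)) ≡⟨ relation E zero (suc l) ⟩
    0ℚ ∎
    where s = x * a′ l + (1ℚ - x) * b′ l

  -- The invariant stores only weak signs for `b″`. The strict ones, which hold after any step, are
  -- kept separately for the argument about the last two colours.
  record Result (a″ b″ : Vector ℚ (suc m)) : Set where
    field
      next      : Elimination (lowerRight X) (lowerRight Y) a″ b″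
      b″-signs  : ∀ j → OppositeSign (X₁ j) (b″ j)
      secondRow : (x ≡ 1ℚ × ∀ j → X₁ j ≡ 1ℚ - X₀ j) ⊎ (x ≡ 0ℚ × ∀ j → X₁ j ≡ X₀ j)

  private
    result : ∀ {a″ b″} →
      (∀ j → SameSign (X₁ j) (a″ j)) → (∀ j → OppositeSign (X₁ j) (b″ j)) →
      (∀ k l → X₁ k * a″ l + (1ℚ - X₁ k) * b″ l ≡ X₀ k * a′ l + (1ℚ - X₀ k) * b′ l + X₁ k * Y₁ l) →
      (x ≡ 1ℚ × ∀ j → X₁ j ≡ 1ℚ - X₀ j) ⊎ (x ≡ 0ℚ × ∀ j → X₁ j ≡ X₀ j) → Result a″ b″
    result {a″} {b″} a″-signs b″-signs regroup secondRow = record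
      { next = record
        { zeroOne = λ i j → zeroOne E (suc i) (suc j)
        ; isHessenberg = record
          { upperHessenberg = λ i j i>j+1 → upperHessenberg (isHessenberg E) (suc i) (suc j) (s≤s i>j+1)
          ; unreduced = λ i j i≡j+1 → unreduced (isHessenberg E) (suc i) (suc j) (cong suc i≡j+1) }
        ; signs = λ i j → signs E (suc i) (suc j)
        ; a-signs = a″-signs
        ; b-signs = λ j → (<⇒≤ ∘ proj₁ (b″-signs j)) , (<⇒≤ ∘ proj₂ (b″-signs j))
        ; relation = λ k l → begin
            X₁ k * a″ l + (1ℚ - X₁ k) * b″ l + rest (suc k) (suc l)
              ≡⟨ cong (_+ rest (suc k) (suc l)) (regroup k l) ⟩
            X₀ k * a′ l + (1ℚ - X₀ k) * b′ l + X₁ k * Y₁ l + rest (suc k) (suc l)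
              ≡⟨ +-assoc (X₀ k * a′ l + (1ℚ - X₀ k) * b′ l) (X₁ k * Y₁ l) (rest (suc k) (suc l)) ⟩
            X₀ k * a′ l + (1ℚ - X₀ k) * b′ l + (X₁ k * Y₁ l + rest (suc k) (suc l))
              ≡⟨ relation E (suc k) (suc l) ⟩
            identity (suc k) (suc l) ≡⟨ identity-suc k l ⟩
            identity k l ∎ }
      ; b″-signs = b″-signs
      ; secondRow = secondRow }

    complement : ∀ {p q} → p ≡ 1ℚ - q → (p ≡ 1ℚ → q ≡ 0ℚ) × (p ≡ 0ℚ → q ≡ 1ℚ)
    complement {p} {q} p≡1-q =
      (λ p≡1 → trans q≡1-p (cong (λ ξ → 1ℚ - ξ) p≡1)) ,
      (λ p≡0 → trans q≡1-p (cong (λ ξ → 1ℚ - ξ) p≡0))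
      where
      q≡1-p : q ≡ 1ℚ - p
      q≡1-p = trans (solve 1 (λ q → q := con 1ℚ :- (con 1ℚ :- q)) refl q) (cong (λ ξ → 1ℚ - ξ) (sym p≡1-q))

  -- If `x` is 1, then `a′` is `- Y₁`, so row 1 has the signs opposite to those of row 0 and is its
  -- complement. Row 1 joins the complementary group, and the groups exchange roles because patterns
  -- are now compared with row 1. If `x` is 0, then `b′` is `- Y₁`; this makes its signs strict, and
  -- they force row 1 to equal row 0 and to join its group.
  step : ∃[ a″ ] ∃[ b″ ] Result a″ b″
  step with zeroOne E zero zero
  ... | inj₂ x≡1 = (λ j → b′ j + Y₁ j) , a′ , result
    (λ j → (λ X₁≡1 → +-mono-≤-< (proj₂ (b-signs E (suc j)) (proj₁ (complement (X₁≡ j)) X₁≡1))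
                               (proj₁ (signs E (suc zero) (suc j)) X₁≡1))
         , (λ X₁≡0 → +-mono-≤-< (proj₁ (b-signs E (suc j)) (proj₂ (complement (X₁≡ j)) X₁≡0))
                               (proj₂ (signs E (suc zero) (suc j)) X₁≡0)))
    (λ j → (λ X₁≡1 → proj₂ (a-signs E (suc j)) (proj₁ (complement (X₁≡ j)) X₁≡1))
         , (λ X₁≡0 → proj₁ (a-signs E (suc j)) (proj₂ (complement (X₁≡ j)) X₁≡0)))
    (λ k l → trans (cong (λ ξ → ξ * (b′ l + Y₁ l) + (1ℚ - ξ) * a′ l) (X₁≡ k))
      (trans (solve 4 (λ x a b y → (con 1ℚ :- x) :* (b :+ y) :+ (con 1ℚ :- (con 1ℚ :- x)) :* a
                        := x :* a :+ (con 1ℚ :- x) :* b :+ (con 1ℚ :- x) :* y) refl (X₀ k) (a′ l) (b′ l) (Y₁ l))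
        (cong (λ ξ → X₀ k * a′ l + (1ℚ - X₀ k) * b′ l + ξ * Y₁ l) (sym (X₁≡ k)))))
    (inj₁ (x≡1 , X₁≡))
    where
    a≡-Y : ∀ j → a′ j ≡ - Y₁ j
    a≡-Y j = sum-zero⇒neg (trans
      (solve 3 (λ a b y → a :+ y := con 1ℚ :* a :+ (con 1ℚ :- con 1ℚ) :* b :+ y) refl (a′ j) (b′ j) (Y₁ j))
      (trans (cong (λ ξ → ξ * a′ j + (1ℚ - ξ) * b′ j + Y₁ j) (sym x≡1)) (firstColumn j)))
    X₁≡ : ∀ j → X₁ j ≡ 1ℚ - X₀ j
    X₁≡ j with zeroOne E zero (suc j) | zeroOne E (suc zero) (suc j)
    ... | inj₁ X₀≡0 | inj₂ X₁≡1 = trans X₁≡1 (cong (λ ξ → 1ℚ - ξ) (sym X₀≡0))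
    ... | inj₂ X₀≡1 | inj₁ X₁≡0 = trans X₁≡0 (cong (λ ξ → 1ℚ - ξ) (sym X₀≡1))
    ... | inj₁ X₀≡0 | inj₁ X₁≡0 = ⊥-elim (<-asym (proj₂ (a-signs E (suc j)) X₀≡0)
      (subst (0ℚ <_) (sym (a≡-Y j)) (neg-antimono-< (proj₂ (signs E (suc zero) (suc j)) X₁≡0))))
    ... | inj₂ X₀≡1 | inj₂ X₁≡1 = ⊥-elim (<-asym (proj₁ (a-signs E (suc j)) X₀≡1)
      (subst (_< 0ℚ) (sym (a≡-Y j)) (neg-antimono-< (proj₁ (signs E (suc zero) (suc j)) X₁≡1))))
  ... | inj₁ x≡0 = (λ j → a′ j + Y₁ j) , b′ , result
    (λ j → (λ X₁≡1 → +-mono-< (proj₁ (a-signs E (suc j)) (trans (sym (X₁≡ j)) X₁≡1))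
                               (proj₁ (signs E (suc zero) (suc j)) X₁≡1))
         , (λ X₁≡0 → +-mono-< (proj₂ (a-signs E (suc j)) (trans (sym (X₁≡ j)) X₁≡0))
                               (proj₂ (signs E (suc zero) (suc j)) X₁≡0)))
    (λ j → b<0 j , 0<b j)
    (λ k l → trans (cong (λ ξ → ξ * (a′ l + Y₁ l) + (1ℚ - ξ) * b′ l) (X₁≡ k))
      (trans (solve 4 (λ x a b y → x :* (a :+ y) :+ (con 1ℚ :- x) :* b
                        := x :* a :+ (con 1ℚ :- x) :* b :+ x :* y) refl (X₀ k) (a′ l) (b′ l) (Y₁ l))
        (cong (λ ξ → X₀ k * a′ l + (1ℚ - X₀ k) * b′ l + ξ * Y₁ l) (sym (X₁≡ k)))))
    (inj₂ (x≡0 , X₁≡))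
    where
    b≡-Y : ∀ j → b′ j ≡ - Y₁ j
    b≡-Y j = sum-zero⇒neg (trans
      (solve 3 (λ a b y → b :+ y := con 0ℚ :* a :+ (con 1ℚ :- con 0ℚ) :* b :+ y) refl (a′ j) (b′ j) (Y₁ j))
      (trans (cong (λ ξ → ξ * a′ j + (1ℚ - ξ) * b′ j + Y₁ j) (sym x≡0)) (firstColumn j)))
    b<0 : ∀ j → X₁ j ≡ 1ℚ → b′ j < 0ℚ
    b<0 j X₁≡1 = subst (_< 0ℚ) (sym (b≡-Y j)) (neg-antimono-< (proj₁ (signs E (suc zero) (suc j)) X₁≡1))
    0<b : ∀ j → X₁ j ≡ 0ℚ → 0ℚ < b′ j
    0<b j X₁≡0 = subst (0ℚ <_) (sym (b≡-Y j)) (neg-antimono-< (proj₂ (signs E (suc zero) (suc j)) X₁≡0))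
    X₁≡ : ∀ j → X₁ j ≡ X₀ j
    X₁≡ j with zeroOne E zero (suc j) | zeroOne E (suc zero) (suc j)
    ... | inj₁ X₀≡0 | inj₁ X₁≡0 = trans X₁≡0 (sym X₀≡0)
    ... | inj₂ X₀≡1 | inj₂ X₁≡1 = trans X₁≡1 (sym X₀≡1)
    ... | inj₁ X₀≡0 | inj₂ X₁≡1 =
      ⊥-elim (<-irrefl refl (<-≤-trans (b<0 j X₁≡1) (proj₂ (b-signs E (suc j)) X₀≡0)))
    ... | inj₂ X₀≡1 | inj₁ X₁≡0 =
      ⊥-elim (<-irrefl refl (<-≤-trans (0<b j X₁≡0) (proj₁ (b-signs E (suc j)) X₀≡1)))

  -- If `x` is 1, row 0 has colour `c 0` and complementing it gives `not (c 0)`; if `x` is 0, row 0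
  -- already has the colour `not (c 0)`.
  secondRow-colours : ∀ {a″ b″} → Result a″ b″ → ∀ e (c : ℕ → Bool) → (∀ j → X zero j ≡ agree e (c (toℕ j))) →
    ∀ j → X₁ j ≡ agree (not (c 0)) (c (suc (toℕ j)))
  secondRow-colours R e c X₀≡ j = colour e (c 0) (c (suc (toℕ j))) (X₀≡ zero) (X₀≡ (suc j)) (Result.secondRow R)
    where
    colour : ∀ e d d′ → x ≡ agree e d → X₀ j ≡ agree e d′ →
      (x ≡ 1ℚ × ∀ j → X₁ j ≡ 1ℚ - X₀ j) ⊎ (x ≡ 0ℚ × ∀ j → X₁ j ≡ X₀ j) → X₁ j ≡ agree (not d) d′
    colour true  true  true  _ X₀≡ (inj₁ (_ , X₁≡)) = trans (X₁≡ j) (cong (λ ξ → 1ℚ - ξ) X₀≡)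
    colour true  true  false _ X₀≡ (inj₁ (_ , X₁≡)) = trans (X₁≡ j) (cong (λ ξ → 1ℚ - ξ) X₀≡)
    colour true  false _ x≡0 _ (inj₁ (x≡1 , _)) = ⊥-elim (1≢0 (trans (sym x≡1) x≡0))
    colour false true  _ x≡0 _ (inj₁ (x≡1 , _)) = ⊥-elim (1≢0 (trans (sym x≡1) x≡0))
    colour false false true  _ X₀≡ (inj₁ (_ , X₁≡)) = trans (X₁≡ j) (cong (λ ξ → 1ℚ - ξ) X₀≡)
    colour false false false _ X₀≡ (inj₁ (_ , X₁≡)) = trans (X₁≡ j) (cong (λ ξ → 1ℚ - ξ) X₀≡)
    colour true  true  _ x≡1 _ (inj₂ (x≡0 , _)) = ⊥-elim (1≢0 (trans (sym x≡1) x≡0))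
    colour false false _ x≡1 _ (inj₂ (x≡0 , _)) = ⊥-elim (1≢0 (trans (sym x≡1) x≡0))
    colour true  false _ _ X₀≡ (inj₂ (_ , X₁≡)) = trans (X₁≡ j) X₀≡
    colour false true  _ _ X₀≡ (inj₂ (_ , X₁≡)) = trans (X₁≡ j) X₀≡

open Step using (Result; step; firstColumn; secondRow-colours)

elimination⇒hess : ∀ {m} {X Y : Matrix (suc m)} {a b} → Elimination X Y a b →
  ∀ e (c : ℕ → Bool) → (∀ j → X zero j ≡ agree e (c (toℕ j))) → ∀ i j → X i j ≡ hess e c (toℕ i) (toℕ j)
elimination⇒hess E e c X₀≡ zero j = X₀≡ j
elimination⇒hess E e c X₀≡ (suc zero) zero = subdiagonal≡1 (zeroOne E) (isHessenberg E) (suc zero) zero refl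
elimination⇒hess E e c X₀≡ (suc (suc i)) zero =
  upperHessenberg (isHessenberg E) (suc (suc i)) zero (s≤s (s≤s z≤n))
elimination⇒hess {suc m} E e c X₀≡ (suc i) (suc j) =
  let _ , _ , R = step E in
  elimination⇒hess (Result.next R) (not (c 0)) (c ∘ suc) (secondRow-colours E R e c X₀≡) i j

-- Steps reduce to two columns. If these had equal colours, the entry of row 1 in the second column
-- would be 0, and the relation of that column with the first normal would leave `a zero` or
-- `b zero` alone on its left side. That value would vanish, against its strict sign.
lastColours-distinct : ∀ {m} {X Y : Matrix (suc (suc m))} {a b} → Elimination X Y a b →
  (∀ j → OppositeSign (X zero j) (b j)) →
  ∀ e (c : ℕ → Bool) → (∀ j → X zero j ≡ agree e (c (toℕ j))) → c m ≢ c (suc m)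
lastColours-distinct {zero} {X} {Y} {a} {b} E b-signs e c X₀≡ c₀≡c₁ =
  conflict (Result.secondRow (proj₂ (proj₂ (step E))))
  where
  X₀₁≡X₀₀ : X zero (suc zero) ≡ X zero zero
  X₀₁≡X₀₀ = trans (X₀≡ (suc zero)) (trans (cong (agree e) (sym c₀≡c₁)) (sym (X₀≡ zero)))
  vanish : ∀ {x y} → X zero (suc zero) ≡ x → X (suc zero) (suc zero) ≡ y →
    x * a zero + (1ℚ - x) * b zero + (y * Y (suc zero) zero + 0ℚ) ≡ 0ℚ
  vanish refl refl = relation E (suc zero) zero
  conflict : (X zero zero ≡ 1ℚ × (∀ j → X (suc zero) (suc j) ≡ 1ℚ - X zero (suc j))) ⊎
             (X zero zero ≡ 0ℚ × (∀ j → X (suc zero) (suc j) ≡ X zero (suc j))) → ⊥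
  conflict (inj₁ (x≡1 , X₁≡)) = <-irrefl (sym a≡0) (proj₁ (a-signs E zero) x≡1)
    where
    a≡0 : a zero ≡ 0ℚ
    a≡0 = trans (solve 3 (λ a b y → a := con 1ℚ :* a :+ (con 1ℚ :- con 1ℚ) :* b :+ ((con 1ℚ :- con 1ℚ) :* y :+ con 0ℚ))
                   refl (a zero) (b zero) (Y (suc zero) zero))
      (vanish (trans X₀₁≡X₀₀ x≡1) (trans (X₁≡ zero) (cong (λ ξ → 1ℚ - ξ) (trans X₀₁≡X₀₀ x≡1))))
  conflict (inj₂ (x≡0 , X₁≡)) = <-irrefl (sym b≡0) (proj₂ (b-signs zero) x≡0)
    where
    b≡0 : b zero ≡ 0ℚ
    b≡0 = trans (solve 3 (λ a b y → b := con 0ℚ :* a :+ (con 1ℚ :- con 0ℚ) :* b :+ (con 0ℚ :* y :+ con 0ℚ))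
                   refl (a zero) (b zero) (Y (suc zero) zero))
      (vanish (trans X₀₁≡X₀₀ x≡0) (trans (X₁≡ zero) (trans X₀₁≡X₀₀ x≡0)))
lastColours-distinct {suc m} E b-signs e c X₀≡ =
  let _ , _ , R = step E in
  lastColours-distinct (Result.next R) (Result.b″-signs R) (not (c 0)) (c ∘ suc)
    (secondRow-colours E R e c X₀≡)

rowColours : ∀ {n} → Vector ℚ n → ℕ → Bool
rowColours {zero}  x _       = true
rowColours {suc n} x zero    = does (x zero ≟ 1ℚ)
rowColours {suc n} x (suc j) = rowColours (x ∘ suc) j

rowColours-agree : ∀ {n} (x : Vector ℚ n) → (∀ j → Is01 (x j)) →
  ∀ j → x j ≡ agree true (rowColours x (toℕ j))
rowColours-agree x x-01 zero with x-01 zero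
... | inj₁ x≡0 = trans x≡0
  (cong (agree true) (sym (dec-false (x zero ≟ 1ℚ) λ x≡1 → 1≢0 (trans (sym x≡1) x≡0))))
... | inj₂ x≡1 = trans x≡1 (cong (agree true) (sym (dec-true (x zero ≟ 1ℚ) x≡1)))
rowColours-agree x x-01 (suc j) = rowColours-agree (x ∘ suc) (x-01 ∘ suc) j

acute⇒hess : ∀ {m} (H : Matrix (suc (suc (suc m)))) → IsUnreducedUpperHessenberg H → Is01Matrix H →
  AcuteDual (transpose H) →
  ∃[ c ] c 0 ≡ true × c (suc m) ≢ c (suc (suc m)) × (∀ i j → H i j ≡ hess true c (toℕ i) (toℕ j))
acute⇒hess {m} H H-hess H-01 A =
  c , c₀≡true (c 0) refl
  -- The initial `b` is zero and has no strict signs, so the argument starts after one step.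
  , (let _ , _ , R = step E in
     lastColours-distinct (Result.next R) (Result.b″-signs R) (not (c 0)) (c ∘ suc) (secondRow-colours E R true c H₀≡))
  , elimination⇒hess E true c H₀≡
  where
  open AcuteDual A using (dual) renaming (normal to q)
  open NormalSigns H H-01 A
  E : Elimination H (transpose q) (transpose q zero) (λ _ → 0ℚ)
  E = record
    { zeroOne = H-01 ; isHessenberg = H-hess ; signs = λ _ _ → normal-pos , normal-neg
    ; a-signs = λ _ → normal-pos , normal-neg ; b-signs = λ _ → (λ _ → ≤-refl) , (λ _ → ≤-refl)
    ; relation = λ k l → trans
        (solve 3 (λ x a s → x :* a :+ (con 1ℚ :- x) :* con 0ℚ :+ s := x :* a :+ s) refl
          (H zero k) (q l zero) (sum λ i → H (suc i) k * q l (suc i)))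
        (dual k l) }
  c : ℕ → Bool
  c = rowColours (H zero)
  H₀≡ : ∀ j → H zero j ≡ agree true (c (toℕ j))
  H₀≡ = rowColours-agree (H zero) (H-01 zero)
  -- A corner entry 0 would equate row 1 of the normals with `- b`, which is zero at the start,
  -- whereas every entry of a normal has a strict sign.
  c₀≡true : ∀ d → c 0 ≡ d → c 0 ≡ true
  c₀≡true true  c₀≡ = c₀≡
  c₀≡true false c₀≡ = ⊥-elim (conflict (H-01 (suc zero) (suc zero)))
    where
    q₁≡0 : q (suc zero) (suc zero) ≡ 0ℚ
    q₁≡0 = trans (solve 2 (λ a y → y := con 0ℚ :* a :+ (con 1ℚ :- con 0ℚ) :* con 0ℚ :+ y) refl
                    (q (suc zero) zero) (q (suc zero) (suc zero)))
      (trans (cong (λ ξ → ξ * q (suc zero) zero + (1ℚ - ξ) * 0ℚ + q (suc zero) (suc zero))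
                (sym (trans (H₀≡ zero) (cong (agree true) c₀≡))))
        (firstColumn E zero))
    conflict : Is01 (H (suc zero) (suc zero)) → ⊥
    conflict (inj₁ H≡0) = <-irrefl q₁≡0 (normal-neg H≡0)
    conflict (inj₂ H≡1) = <-irrefl (sym q₁≡0) (normal-pos H≡1)

-- The ultrametric pattern

UltrametricTriple : ∀ {n} → Matrix n → (Fin 3 → Fin n) → Set
UltrametricTriple G s =
  Σ[ π ∈ Permutation′ 3 ] ∃[ a ] ∃[ b ] ∃[ c ] ∃[ d ] ∃[ f ]
    (∀ p q → G (s (π ⟨$⟩ʳ p)) (s (π ⟨$⟩ʳ q)) ≡ ultrametricPattern a b c d f p q)
    × a ≤ b × b < c × c ≤ d × a < f

module _ {n} {G : Matrix n} (G-sym : ∀ i j → G i j ≡ G j i)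
         (ultra : ∀ i j k → G i k ≤ G i j ⊎ G k j ≤ G i j)
         (diagonal : ∀ i j → i ≢ j → G i j < G i i) where

  private
    p₀ p₁ p₂ : Fin 3
    p₀ = zero
    p₁ = suc zero
    p₂ = suc (suc zero)

    permute : ∀ (ρ : Permutation′ 3) s → UltrametricTriple G (s ∘ (ρ ⟨$⟩ʳ_)) → UltrametricTriple G s
    permute ρ s (π , rest) = π ∘ₚ ρ , rest

    swap : ∀ {i j k l} → G i j ≤ G k l → G j i ≤ G l k
    swap {i} {j} {k} {l} = subst₂ _≤_ (G-sym i j) (G-sym k l)

    swapˡ : ∀ {i j x} → G i j ≤ x → G j i ≤ x
    swapˡ {i} {j} {x} = subst (_≤ x) (G-sym i j)

    swapʳ : ∀ {i j x} → x ≤ G i j → x ≤ G j i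
    swapʳ {i} {j} {x} = subst (x ≤_) (G-sym i j)

    -- Once `G x y` is the largest off-diagonal entry, the ultrametric inequality makes the other
    -- two equal. Their common value is the `a` of the pattern.
    sorted : ∀ s → s p₀ ≢ s p₁ → s p₀ ≢ s p₂ → G (s p₀) (s p₂) ≤ G (s p₀) (s p₁) →
      G (s p₁) (s p₂) ≤ G (s p₀) (s p₁) → G (s p₁) (s p₁) ≤ G (s p₀) (s p₀) → UltrametricTriple G s
    sorted s x≢y x≢z xz≤xy yz≤xy yy≤xx =
      Permutation.id , G x z , G x y , G y y , G x x , G z z , entries
      , xz≤xy , subst (_< G y y) (G-sym y x) (diagonal y x (x≢y ∘ sym)) , yy≤xx
      , subst (_< G z z) (G-sym z x) (diagonal z x (x≢z ∘ sym))
      where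
      x = s p₀
      y = s p₁
      z = s p₂
      yz≤xz : G y z ≤ G x z
      yz≤xz = Sum.[ ≤-trans yz≤xy , (λ yz≤xz → yz≤xz) ]′ (ultra x z y)
      xz≤yz : G x z ≤ G y z
      xz≤yz = Sum.[ (λ yx≤yz → ≤-trans xz≤xy (swapˡ yx≤yz)) , (λ xz≤yz → xz≤yz) ]′ (ultra y z x)
      yz≡xz : G y z ≡ G x z
      yz≡xz = ≤-antisym yz≤xz xz≤yz
      entries : ∀ p q → G (s p) (s q) ≡ ultrametricPattern (G x z) (G x y) (G y y) (G x x) (G z z) p q
      entries zero             zero             = refl
      entries zero             (suc zero)       = refl
      entries zero             (suc (suc zero)) = refl
      entries (suc zero)       zero             = G-sym y x
      entries (suc zero)       (suc zero)       = refl
      entries (suc zero)       (suc (suc zero)) = yz≡xz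
      entries (suc (suc zero)) zero             = G-sym z x
      entries (suc (suc zero)) (suc zero)       = trans (G-sym z y) yz≡xz
      entries (suc (suc zero)) (suc (suc zero)) = refl

    maximal₀₁ : ∀ s → s p₀ ≢ s p₁ → s p₀ ≢ s p₂ → s p₁ ≢ s p₂ →
      G (s p₀) (s p₂) ≤ G (s p₀) (s p₁) → G (s p₁) (s p₂) ≤ G (s p₀) (s p₁) → UltrametricTriple G s
    maximal₀₁ s x≢y x≢z y≢z xz≤xy yz≤xy with ≤-total (G (s p₁) (s p₁)) (G (s p₀) (s p₀))
    ... | inj₁ yy≤xx = sorted s x≢y x≢z xz≤xy yz≤xy yy≤xx
    ... | inj₂ xx≤yy = permute ρ s (sorted (s ∘ (ρ ⟨$⟩ʳ_)) (x≢y ∘ sym) y≢z (swapʳ yz≤xy) (swapʳ xz≤xy) xx≤yy)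
      where ρ = Permutation.transpose p₀ p₁

    triple : ∀ s → s p₀ ≢ s p₁ → s p₀ ≢ s p₂ → s p₁ ≢ s p₂ → UltrametricTriple G s
    triple s x≢y x≢z y≢z
      with ≤-total (G (s p₀) (s p₂)) (G (s p₀) (s p₁))
         | ≤-total (G (s p₀) (s p₁)) (G (s p₁) (s p₂))
         | ≤-total (G (s p₀) (s p₂)) (G (s p₁) (s p₂))
    ... | inj₁ xz≤xy | inj₂ yz≤xy | _ = maximal₀₁ s x≢y x≢z y≢z xz≤xy yz≤xy
    ... | inj₂ xy≤xz | _ | inj₂ yz≤xz = permute ρ s
      (maximal₀₁ (s ∘ (ρ ⟨$⟩ʳ_)) x≢z x≢y (y≢z ∘ sym) xy≤xz (swapˡ yz≤xz))
      where ρ = Permutation.transpose p₁ p₂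
    ... | inj₁ xz≤xy | inj₁ xy≤yz | _ = permute ρ s
      (maximal₀₁ (s ∘ (ρ ⟨$⟩ʳ_)) (y≢z ∘ sym) (x≢z ∘ sym) (x≢y ∘ sym) (swap (≤-trans xz≤xy xy≤yz)) (swap xy≤yz))
      where ρ = Permutation.transpose p₀ p₂
    ... | inj₂ xy≤xz | _ | inj₁ xz≤yz = permute ρ s
      (maximal₀₁ (s ∘ (ρ ⟨$⟩ʳ_)) (y≢z ∘ sym) (x≢z ∘ sym) (x≢y ∘ sym) (swap xz≤yz) (swap (≤-trans xy≤xz xz≤yz)))
      where ρ = Permutation.transpose p₀ p₂

  isStrictlyUltrametric : IsStrictlyUltrametric G
  isStrictlyUltrametric = record
    { symmetric = G-sym
    ; threeByThree = λ s mono → triple s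
        (Fin.<⇒≢ (mono p₀ p₁ (s≤s z≤n))) (Fin.<⇒≢ (mono p₀ p₂ (s≤s z≤n)))
        (Fin.<⇒≢ (mono p₁ p₂ (s≤s (s≤s z≤n)))) }

addOnes-strictlyUltrametric : ∀ {n} {c : Fin n → Bool} {W G : Matrix n} → IsColourUltrametric c W →
  (∀ i j → G i j ≡ addOuter (λ _ → 1ℚ) W i j) → IsStrictlyUltrametric G
addOnes-strictlyUltrametric {W = W} {G} U G≗ = isStrictlyUltrametric
  (λ i j → trans (G≗ i j) (trans (cong (λ ξ → 1ℚ + ξ) (symmetric i j)) (sym (G≗ j i))))
  (λ i j k → Sum.map (raise i k i j) (raise k j i j) (ultra i j k))
  (λ i j i≢j → subst₂ _<_ (sym (G≗ i j)) (sym (G≗ i i)) (+-monoʳ-< 1ℚ (diagonal i j i≢j)))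
  where
  open IsColourUltrametric U
  raise : ∀ i j k l → W i j ≤ W k l → G i j ≤ G k l
  raise i j k l W≤W = subst₂ _≤_ (sym (G≗ i j)) (sym (G≗ k l)) (+-monoʳ-≤ 1ℚ W≤W)

-- Exchanging rows and columns

hess-not : ∀ e c i j → hess (not e) (not ∘ c) i j ≡ hess e c i j
hess-not e c zero          j       = agree-not-not e (c j)
hess-not e c (suc zero)    zero    = refl
hess-not e c (suc (suc i)) zero    = refl
hess-not e c (suc i)       (suc j) = hess-not (not (c 0)) (c ∘ suc) i j

hess-cong : ∀ {n e e′ c c′} → e ≡ e′ → (∀ j → j ℕ.< n → c j ≡ c′ j) →
  ∀ i {j} → j ℕ.< n → hess e c i j ≡ hess e′ c′ i j
hess-cong {e = e} refl c≗ zero j<n = cong (agree e) (c≗ _ j<n)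
hess-cong e≡ c≗ (suc zero)    {zero}  j<n = refl
hess-cong e≡ c≗ (suc (suc i)) {zero}  j<n = refl
hess-cong e≡ c≗ (suc i)       {suc j} (s≤s j<n) =
  hess-cong (cong not (c≗ 0 (s≤s z≤n))) (λ j j<n → c≗ (suc j) (s≤s j<n)) i j<n

flipTail : (ℕ → Bool) → ℕ → Bool
flipTail c zero    = c zero
flipTail c (suc j) = not (c (suc j))

-- Rows 0 and 1 both have a 1 in column 0 and opposite colours. Exchanging them therefore amounts to
-- flipping all later columns; the rows below flip along with these columns.
hess-swapFirstTwo : ∀ {n} c → c 0 ≡ true → ∀ (i : Fin (suc (suc n))) j →
  hess true c (toℕ (swapFirstTwo i)) j ≡ hess true (flipTail c) (toℕ i) j
hess-swapFirstTwo c c₀ zero       zero    rewrite c₀ = refl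
hess-swapFirstTwo c c₀ zero       (suc j) rewrite c₀ = agree-notˡ true (c (suc j))
hess-swapFirstTwo c c₀ (suc zero) zero    rewrite c₀ = refl
hess-swapFirstTwo c c₀ (suc zero) (suc j) rewrite c₀ = sym (agree-not-not true (c (suc j)))
hess-swapFirstTwo c c₀ (suc (suc i)) zero    = refl
hess-swapFirstTwo c c₀ (suc (suc i)) (suc j) = sym (trans
  (hess-lowerRows (not (c 0)) (not (not (c 0))) (not ∘ c ∘ suc) (toℕ i) j)
  (hess-not (not (c 0)) (c ∘ suc) (suc (toℕ i)) j))

flipFrom : ℕ → (ℕ → Bool) → ℕ → Bool
flipFrom zero    c j       = not (c j)
flipFrom (suc k) c zero    = c zero
flipFrom (suc k) c (suc j) = flipFrom k (c ∘ suc) j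

flipFrom-below : ∀ k c {j} → j ℕ.< k → flipFrom k c j ≡ c j
flipFrom-below (suc k) c {zero}  _         = refl
flipFrom-below (suc k) c {suc j} (s≤s j<k) = flipFrom-below k (c ∘ suc) j<k

flipFrom-above : ∀ k c {j} → k ℕ.≤ j → flipFrom k c j ≡ not (c j)
flipFrom-above zero    c _         = refl
flipFrom-above (suc k) c (s≤s k≤j) = flipFrom-above k (c ∘ suc) k≤j

swapFirstTwo-inject₁ : ∀ {n} (i : Fin (suc (suc n))) → swapFirstTwo (inject₁ i) ≡ inject₁ (swapFirstTwo i)
swapFirstTwo-inject₁ zero          = refl
swapFirstTwo-inject₁ (suc zero)    = refl
swapFirstTwo-inject₁ (suc (suc i)) = refl

opposite-inject₁ : ∀ {n} (i : Fin n) → opposite (inject₁ i) ≡ suc (opposite i)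
opposite-inject₁ zero    = refl
opposite-inject₁ (suc i) = cong inject₁ (opposite-inject₁ i)

swapLastTwo-zero : ∀ n → swapLastTwo {suc (suc (suc n))} zero ≡ zero
swapLastTwo-zero n = Fin.opposite-involutive {suc (suc (suc n))} zero

swapLastTwo-suc : ∀ {n} (j : Fin (suc (suc n))) → swapLastTwo (suc j) ≡ suc (swapLastTwo j)
swapLastTwo-suc j =
  trans (cong opposite (swapFirstTwo-inject₁ (opposite j))) (opposite-inject₁ (swapFirstTwo (opposite j)))

-- As the two colours are opposite, exchanging the columns flips both. In the last row, where one
-- entry is subdiagonal, both entries are 1 before and after.
hess-swapLastTwo : ∀ m e c → c m ≢ c (suc m) → ∀ (i j : Fin (suc (suc m))) →
  hess e c (toℕ i) (toℕ (swapLastTwo j)) ≡ hess e (flipFrom m c) (toℕ i) (toℕ j)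
hess-swapLastTwo zero e c c≢c zero zero = cong (agree e) (Bool.¬-not (c≢c ∘ sym))
hess-swapLastTwo zero e c c≢c zero (suc zero) = cong (agree e) (Bool.¬-not c≢c)
hess-swapLastTwo zero e c c≢c (suc zero) zero = agree-not-≢ c≢c
hess-swapLastTwo zero e c c≢c (suc zero) (suc zero) =
  sym (trans (agree-not-not (not (c 0)) (c 1)) (agree-not-≢ c≢c))
hess-swapLastTwo (suc m) e c c≢c i zero rewrite swapLastTwo-zero m = zerothColumn i
  where
  zerothColumn : ∀ {n} (i : Fin n) → hess e c (toℕ i) 0 ≡ hess e (flipFrom (suc m) c) (toℕ i) 0
  zerothColumn zero          = refl
  zerothColumn (suc zero)    = refl
  zerothColumn (suc (suc i)) = refl
hess-swapLastTwo (suc m) e c c≢c zero (suc j) rewrite swapLastTwo-suc j =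
  hess-swapLastTwo m e (c ∘ suc) c≢c zero j
hess-swapLastTwo (suc m) e c c≢c (suc i) (suc j) rewrite swapLastTwo-suc j =
  hess-swapLastTwo m (not (c 0)) (c ∘ suc) c≢c i j

-- Run lengths

-- The bounds on the end runs are conditional on the colours at the ends, so that the recursion over
-- columns can carry them for every colouring.
record Runs (c : ℕ → Bool) (m : ℕ) : Set where
  field
    {k}      : ℕ
    parts    : Vec ℕ (suc k)
    nonZeros : All NonZero parts
    total    : Vec.sum parts ≡ suc m
    colours  : ∀ j → j ℕ.≤ m → blockColour (c 0) parts j ≡ c j
    first≥2  : m ≥ 1 → c 0 ≡ c 1 → Vec.head parts ≥ 2
    last≥2   : ∀ {l} → m ≡ suc l → c l ≡ c m → Vec.last parts ≥ 2

last-suc-head : ∀ {k} a (as : Vec ℕ k) → Vec.last (a Vec.∷ as) ℕ.≤ Vec.last (suc a Vec.∷ as)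
last-suc-head a Vec.[]         = ℕ.n≤1+n a
last-suc-head a (b Vec.∷ as) = ℕ.≤-refl

runs : ∀ c m → Runs c m
runs c zero = record
  { parts = 1 Vec.∷ Vec.[] ; nonZeros = _ All.∷ All.[] ; total = refl
  ; colours = λ { zero _ → refl } ; first≥2 = λ () ; last≥2 = λ () }
runs c (suc zero) with c 0 Bool.≟ c 1
... | yes c₀≡c₁ = record
  { parts = 2 Vec.∷ Vec.[] ; nonZeros = _ All.∷ All.[] ; total = refl
  ; colours = λ { zero _ → refl ; (suc zero) _ → c₀≡c₁ ; (suc (suc _)) (s≤s ()) }
  ; first≥2 = λ _ _ → ℕ.≤-refl ; last≥2 = λ _ _ → ℕ.≤-refl }
... | no c₀≢c₁ = record
  { parts = 1 Vec.∷ 1 Vec.∷ Vec.[] ; nonZeros = _ All.∷ _ All.∷ All.[] ; total = refl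
  ; colours = λ { zero _ → refl ; (suc zero) _ → sym (Bool.¬-not (c₀≢c₁ ∘ sym)) ; (suc (suc _)) (s≤s ()) }
  ; first≥2 = λ _ c₀≡c₁ → ⊥-elim (c₀≢c₁ c₀≡c₁) ; last≥2 = λ { refl c₀≡c₁ → ⊥-elim (c₀≢c₁ c₀≡c₁) } }
runs c (suc (suc m)) with runs (c ∘ suc) (suc m) | c 0 Bool.≟ c 1
... | record { parts = a Vec.∷ as ; nonZeros = a≢0 All.∷ nz ; total = total ; colours = colours ; last≥2 = last≥2 }
    | yes c₀≡c₁ = record
  { parts = suc a Vec.∷ as ; nonZeros = _ All.∷ nz ; total = cong suc total
  ; colours = λ { zero _ → refl ; (suc j) (s≤s j≤m) →
      trans (cong (λ e → blockColour e (a Vec.∷ as) j) c₀≡c₁) (colours j j≤m) }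
  ; first≥2 = λ _ _ → s≤s (ℕ.>-nonZero⁻¹ a {{a≢0}})
  ; last≥2 = λ { refl c≡c → ℕ.≤-trans (last≥2 refl c≡c) (last-suc-head a as) } }
... | record { parts = a Vec.∷ as ; nonZeros = nz ; total = total ; colours = colours ; last≥2 = last≥2 }
    | no c₀≢c₁ = record
  { parts = 1 Vec.∷ a Vec.∷ as ; nonZeros = _ All.∷ nz ; total = cong suc total
  ; colours = λ { zero _ → refl ; (suc j) (s≤s j≤m) →
      trans (cong (λ e → blockColour e (a Vec.∷ as) j) (sym (Bool.¬-not (c₀≢c₁ ∘ sym)))) (colours j j≤m) }
  ; first≥2 = λ _ c₀≡c₁ → ⊥-elim (c₀≢c₁ c₀≡c₁)
  ; last≥2 = λ { refl c≡c → last≥2 refl c≡c } }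

-- Classification of acute Hessenberg matrices

-- The parts are the runs of all columns but the last. The last column differs in colour from its
-- neighbour, just as the final one-column block of `Hλ` does.
Hλ-fromColours : ∀ m c → c 0 ≡ true → c 1 ≡ true → c m ≡ c (suc m) → c (suc m) ≢ c (suc (suc m)) →
  Σ[ k ∈ ℕ ] Σ[ comp ∈ Composition (suc (suc m)) (suc k) ] EndPartsAtLeast2 comp
    × (∀ i j → hess true c (toℕ i) (toℕ j) ≡ Hλ (suc (suc (suc m))) comp i j)
Hλ-fromColours m c c₀ c₁ cm≡ cm≢ =
  k , record { parts = parts ; positive = nonZeros ; total = total }
  , record { first≥2 = first≥2 (s≤s z≤n) (trans c₀ (sym c₁)) ; last≥2 = last≥2 refl cm≡ }
  , λ i j → trans (hess-cong refl (λ j j<n → sym (colours′ j j<n)) (toℕ i) (Fin.toℕ<n j))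
                  (sym (blockEntry≡hess parts (toℕ i) (toℕ j)))
  where
  open Runs (runs c (suc m))
  colours″ : ∀ j → j ℕ.≤ suc m → blockColour true parts j ≡ c j
  colours″ j j≤ = trans (cong (λ e → blockColour e parts j) (sym c₀)) (colours j j≤)
  colours′ : ∀ j → j ℕ.< suc (suc (suc m)) → blockColour true parts j ≡ c j
  colours′ j (s≤s j≤) with ℕ.m≤n⇒m<n∨m≡n j≤
  ... | inj₁ (s≤s j≤) = colours″ j j≤
  ... | inj₂ refl = trans (blockColour-end true parts nonZeros total)
    (trans (cong not (colours″ (suc m) ℕ.≤-refl)) (sym (Bool.¬-not (cm≢ ∘ sym))))

-- The row exchange is settled first, since for n = 3 it also changes the comparison of colours that
-- decides the column exchange.
acute⇒Hλ : ∀ m (H : Matrix (suc (suc (suc m)))) → IsUnreducedUpperHessenberg H → Is01Matrix H →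
  IsAcute01Simplex (originAndColumns H) →
  Σ[ rows ∈ Bool ] Σ[ cols ∈ Bool ] Σ[ k ∈ ℕ ] Σ[ comp ∈ Composition (suc (suc m)) (suc k) ]
    EndPartsAtLeast2 comp
    × (∀ i j → possibly rows exchangeFirstTwoRows (possibly cols exchangeLastTwoColumns H) i j
               ≡ Hλ (suc (suc (suc m))) comp i j)
acute⇒Hλ m H H-hess H-01 A with acute⇒hess H H-hess H-01 (acuteSimplex⇒acuteDual H A)
... | c , c₀ , c≢ , H≗ = exchangeRows (c 1) refl
  where
  N = suc (suc (suc m))
  Goal : Set
  Goal = Σ[ rows ∈ Bool ] Σ[ cols ∈ Bool ] Σ[ k ∈ ℕ ] Σ[ comp ∈ Composition (suc (suc m)) (suc k) ]
    EndPartsAtLeast2 comp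
    × (∀ i j → possibly rows exchangeFirstTwoRows (possibly cols exchangeLastTwoColumns H) i j ≡ Hλ N comp i j)
  exchangeColumns : ∀ rows c′ → c′ 0 ≡ true → c′ 1 ≡ true → c′ (suc m) ≢ c′ (suc (suc m)) →
    (∀ i j → possibly rows exchangeFirstTwoRows H i j ≡ hess true c′ (toℕ i) (toℕ j)) → Goal
  exchangeColumns rows c′ c₀ c₁ c≢ H≗ with c′ m Bool.≟ c′ (suc m)
  ... | yes c≡ =
    let k , comp , ends , Hλ≗ = Hλ-fromColours m c′ c₀ c₁ c≡ c≢ in
    rows , false , k , comp , ends , λ i j → trans (H≗ i j) (Hλ≗ i j)
  ... | no c≢′ =
    let k , comp , ends , Hλ≗ = Hλ-fromColours m c″ c₀ c″₁
          (trans (flipFrom-below (suc m) c′ (ℕ.n<1+n m))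
            (trans (Bool.¬-not c≢′) (sym (flipFrom-above (suc m) c′ ℕ.≤-refl))))
          (λ c″≡ → c≢ (Bool.not-injective (trans (sym (flipFrom-above (suc m) c′ ℕ.≤-refl))
            (trans c″≡ (flipFrom-above (suc m) c′ (ℕ.n≤1+n (suc m)))))))
    in rows , true , k , comp , ends , λ i j →
      trans (commute rows i j)
        (trans (H≗ i (swapLastTwo j)) (trans (hess-swapLastTwo (suc m) true c′ c≢ i j) (Hλ≗ i j)))
    where
    c″ : ℕ → Bool
    c″ = flipFrom (suc m) c′
    -- For n = 3 the column exchange would flip column 1, but there `c₀` and `c₁` already give the
    -- equality wanted at the right end. So an exchange occurs only for positive `m` and leaves
    -- columns 0 and 1 alone.
    0<m : ∀ m → c′ m ≢ c′ (suc m) → 0 ℕ.< m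
    0<m zero    c≢ = ⊥-elim (c≢ (trans c₀ (sym c₁)))
    0<m (suc m) _  = s≤s z≤n
    c″₁ : c″ 1 ≡ true
    c″₁ = trans (flipFrom-below (suc m) c′ (s≤s (0<m m c≢′))) c₁
    commute : ∀ rows i j →
      possibly rows exchangeFirstTwoRows (exchangeLastTwoColumns H) i j ≡
      possibly rows exchangeFirstTwoRows H i (swapLastTwo j)
    commute true  i j = refl
    commute false i j = refl
  exchangeRows : ∀ d → c 1 ≡ d → Goal
  exchangeRows true  c₁ = exchangeColumns false c c₀ c₁ c≢ H≗
  exchangeRows false c₁ = exchangeColumns true (flipTail c) c₀ (cong not c₁) (c≢ ∘ Bool.not-injective)
    (λ i j → trans (H≗ (swapFirstTwo i) j) (hess-swapFirstTwo c c₀ i (toℕ j)))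

-- Ultrametric Gramians and acuteness of H_λ

module _ (m : ℕ) {k} (comp : Composition (suc (suc m)) (suc k)) (ends : EndPartsAtLeast2 comp) where

  open Composition comp renaming (positive to nonZeros)
  open EndPartsAtLeast2 ends

  private
    n : ℕ
    n = suc (suc (suc m))

    c : ℕ → Bool
    c = blockColour true parts

    c₀≡true : ∀ {k} (as : Vec ℕ (suc k)) → Vec.head as ≥ 2 → blockColour true as 0 ≡ true
    c₀≡true (a Vec.∷ as) (s≤s _) = refl

    c≢c : c (suc m) ≢ c (suc (suc m))
    c≢c c≡c = Bool.not-¬ refl (trans c≡c (blockColour-end true parts nonZeros total))

    Hλ≗ : ∀ i j → Hλ n comp i j ≡ hessenberg (c 0) c i j
    Hλ≗ i j = trans (blockEntry≡hess parts (toℕ i) (toℕ j))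
      (cong (λ e → hess e c (toℕ i) (toℕ j)) (sym (c₀≡true parts first≥2)))

    gram≗ : ∀ i j → gram (Hλ n comp) i j ≡ gram (hessenberg (c 0) c) i j
    gram≗ i j = sum-cong-≗ λ r → cong₂ _*_ (Hλ≗ r i) (Hλ≗ r j)

  gram-Hλ-strictlyUltrametric : IsStrictlyUltrametric (gram (Hλ n comp))
  gram-Hλ-strictlyUltrametric = addOnes-strictlyUltrametric (reduced-ultrametric c m c≢c)
    (λ i j → trans (gram≗ i j) (gram-hessenberg c (suc m) i j))

  Hλ-acute : IsAcute01Simplex (originAndColumns (Hλ n comp))
  Hλ-acute = acuteInverse⇒acuteSimplex (Hλ n comp)
    (λ i j → subst Is01 (sym (Hλ≗ i j)) (hess-01 (c 0) c (toℕ i) (toℕ j)))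
    (hessenberg-acuteInverse c m c≢c gram≗)
    where
    hess-01 : ∀ e c i j → Is01 (hess e c i j)
    hess-01 e c zero          j       = agree-01 e (c j)
    hess-01 e c (suc zero)    zero    = inj₂ refl
    hess-01 e c (suc (suc i)) zero    = inj₁ refl
    hess-01 e c (suc i)       (suc j) = hess-01 (not (c 0)) (c ∘ suc) i j

theorem1p2 : ∀ (n : ℕ) → n ≥ 3 →
    (∀ (H : Matrix n) → IsUnreducedUpperHessenberg H → Is01Matrix H →
    (IsAcute01Simplex (originAndColumns H) ⇔ HasAcuteInverse (gram H))
    × (IsAcute01Simplex (originAndColumns H) →
    Σ[ rows ∈ Bool ] Σ[ cols ∈ Bool ] Σ[ k ∈ ℕ ] Σ[ comp ∈ Composition (pred n) (suc k) ]
    EndPartsAtLeast2 comp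
    × (∀ i j → possibly rows exchangeFirstTwoRows (possibly cols exchangeLastTwoColumns H) i j ≡ Hλ n comp i j)))
    × (∀ (k : ℕ) (comp : Composition (pred n) (suc k)) → EndPartsAtLeast2 comp →
    ∀ (f g : ℕ) .{{_ : NonZero g}} → + f / g ≡ contFracOf comp → gcd f g ≡ 1 →
    ∣ det (Hλ n comp) ∣ ≡ + f / 1)
    × (∀ (k : ℕ) (comp : Composition (pred n) (suc k)) → EndPartsAtLeast2 comp →
    IsStrictlyUltrametric (gram (Hλ n comp))
    × IsAcute01Simplex (originAndColumns (Hλ n comp)))
theorem1p2 (suc (suc (suc m))) (s≤s (s≤s (s≤s z≤n))) =
    (λ H H-hess H-01 →
      mk⇔ (acuteDual⇒acuteInverse H ∘ acuteSimplex⇒acuteDual H) (acuteInverse⇒acuteSimplex H H-01)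
      , acute⇒Hλ m H H-hess H-01)
  , (λ k comp _ f g → det-Hλ (suc (suc m)) comp f g)
  , (λ k comp ends → gram-Hλ-strictlyUltrametric m comp ends , Hλ-acute m comp ends)
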